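{- Let $m\geqslant 3$ be an odd integer. Then the number of distinct $C_4$-face-magic projective labelings on $\mathcal{P}_{m,m}$, counted up to symmetries of the projective plane, is at least $\tau(m,m)\,2^{m-3}\Bigl(\bigl((\tfrac{m-1}{2})!\bigr)^2+2\bigl(\beta(m)\bigr)^2\Bigr)$.
   Context: $\mathcal{P}_{m,n}$ has vertices $(i,j)$, $1\leqslant i\leqslant m$, $1\leqslant j\leqslant n$, and edges $(i,j)$–$(i,j+1)$ ($j\leqslant n-1$), $(i,n)$–$(m+1-i,1)$, $(i,j)$–$(i+1,j)$ ($i\leqslant m-1$), $(m,j)$–$(1,n+1-j)$, embedded naturally in the projective plane. Its 4-cycle faces are $\{(i,j),(i+1,j),(i,j+1),(i+1,j+1)\}$ ($1\leqslant i\leqslant m-1$, $1\leqslant j\leqslant n-1$), $\{(i,n),(i+1,n),(m+1-i,1),(m-i,1)\}$ ($1\leqslant i\leqslant m-1$), $\{(m,j),(m,j+1),(1,n+1-j),(1,n-j)\}$ ($1\leqslant j\leqslant n-1$); the other two faces are digons. A $C_4$-face-magic projective labeling is a bijection from the vertices onto $\{1,\ldots,mn\}$ such that every 4-cycle face has the same label sum. For $\mathcal{P}_{m,m}$ the symmetries are the 8 elements of the dihedral group generated by the rotation $(i,j)\mapsto(m+1-j,i)$ and the reflection $(i,j)\mapsto(i,m+1-j)$; labelings are counted up to precomposition with these. For positive integer $k$, an $(m,n)$-projective factorization sequence is a tuple $(m_1,n_1,\ldots,m_k,n_k)$ of integers $>1$ with $m=m_1\cdots m_k$, $n=n_1\cdots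 n_k$, or a tuple $(m_1,n_1,\ldots,m_k,n_k,m_{k+1})$ of integers $>1$ with $m=m_1\cdots m_{k+1}$, $n=n_1\cdots n_k$; $\tau(m,n)$ is the number of distinct such sequences. For odd $m\geqslant3$, $\beta(m)=\bigl((\tfrac{m-1}{4})!\bigr)^2$ if $m\equiv1\pmod4$ and $\beta(m)=(\tfrac{m-3}{4})!\,(\tfrac{m+1}{4})!$ if $m\equiv3\pmod4$. -}

module Defs where

open import Data.Nat using (ℕ; zero; suc; _+_; _*_; _∸_; _^_; _≤_; _<_; _<?_)
open import Data.Nat.DivMod using (_/_; _%_)
open import Data.Nat using (_!)
open import Data.Fin using (Fin; toℕ; fromℕ<; opposite)
open import Data.Product using (_×_; _,_; Σ; ∃)
open import Data.List using (List; []; _∷_; length)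
open import Data.Nat.ListAction using (product)
open import Data.List.Relation.Unary.All using (All)
open import Data.List.Relation.Unary.Any using (Any)
open import Relation.Binary.PropositionalEquality using (_≡_)
open import Relation.Nullary using (yes; no)
open import Function.Definitions using (Bijective)
open import Data.Bool using (if_then_else_)
open import Data.Nat using (_≡ᵇ_)

-- Vertices of P_{m,n}, 0-based: (a , b) stands for the paper's (a+1 , b+1).
Vertex : ℕ → ℕ → Set
Vertex m n = Fin m × Fin n

-- A labeling: a bijection from the vertices onto {1,…,mn};
-- the vertex v gets the label 1 + toℕ (f v).
IsLabeling : (m n : ℕ) → (Vertex m n → Fin (m * n)) → Set
IsLabeling m n f = Bijective _≡_ _≡_ f

-- Label of the vertex with 0-based coordinates (a , b) (0 outside the grid;
-- only used at in-range coordinates).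
lab : {m n : ℕ} → (Vertex m n → Fin (m * n)) → ℕ → ℕ → ℕ
lab {m} {n} f a b with a <? m | b <? n
... | yes p | yes q = suc (toℕ (f (fromℕ< p , fromℕ< q)))
... | _     | _     = 0

sum4 : ℕ → ℕ → ℕ → ℕ → ℕ
sum4 w x y z = w + x + y + z

-- C4-face-magic: all 4-cycle faces have the same label sum S.
-- Faces in 0-based coordinates (paper index i = a+1, j = b+1):
--  {(a,b),(a+1,b),(a,b+1),(a+1,b+1)}              a < m-1, b < n-1
--  {(a,n-1),(a+1,n-1),(m-1-a,0),(m-2-a,0)}        a < m-1
--  {(m-1,b),(m-1,b+1),(0,n-1-b),(0,n-2-b)}        b < n-1
IsFaceMagic : (m n : ℕ) → (Vertex m n → Fin (m * n)) → Set
IsFaceMagic m n f = Σ ℕ λ S →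
    (∀ a b → suc a < m → suc b < n →
       sum4 (lab f a b) (lab f (suc a) b) (lab f a (suc b)) (lab f (suc a) (suc b)) ≡ S)
  × (∀ a → suc a < m →
       sum4 (lab f a (n ∸ 1)) (lab f (suc a) (n ∸ 1))
            (lab f (m ∸ 1 ∸ a) 0) (lab f (m ∸ 2 ∸ a) 0) ≡ S)
  × (∀ b → suc b < n →
       sum4 (lab f (m ∸ 1) b) (lab f (m ∸ 1) (suc b))
            (lab f 0 (n ∸ 1 ∸ b)) (lab f 0 (n ∸ 2 ∸ b)) ≡ S)

MagicLabeling : ℕ → ℕ → Set
MagicLabeling m n = Σ (Vertex m n → Fin (m * n)) λ f → IsLabeling m n f × IsFaceMagic m n f

-- Symmetries of P_{m,m}: dihedral group generated by
-- rotation (i,j) ↦ (m+1-j, i) and reflection (i,j) ↦ (i, m+1-j).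
rot : {m : ℕ} → Vertex m m → Vertex m m
rot (a , b) = (opposite b , a)

refl' : {m : ℕ} → Vertex m m → Vertex m m
refl' (a , b) = (a , opposite b)

iter : {A : Set} → ℕ → (A → A) → A → A
iter zero    g x = x
iter (suc k) g x = g (iter k g x)

symmetries : (m : ℕ) → List (Vertex m m → Vertex m m)
symmetries m =
    (λ v → iter 0 rot v) ∷ (λ v → iter 1 rot v) ∷ (λ v → iter 2 rot v) ∷ (λ v → iter 3 rot v)
  ∷ (λ v → iter 0 rot (refl' v)) ∷ (λ v → iter 1 rot (refl' v))
  ∷ (λ v → iter 2 rot (refl' v)) ∷ (λ v → iter 3 rot (refl' v)) ∷ []

Equivalent : {m : ℕ} → (f g : Vertex m m → Fin (m * m)) → Set
Equivalent {m} f g = Any (λ σ → ∀ v → g v ≡ f (σ v)) (symmetries m)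

-- Projective factorization sequences, as lists [m1,n1,...,mk,nk] or
-- [m1,n1,...,mk,nk,m(k+1)] with k ≥ 1 (i.e. length ≥ 2).
odds : List ℕ → List ℕ   -- entries at positions 0,2,4,…  (the m_i)
evens : List ℕ → List ℕ  -- entries at positions 1,3,5,…  (the n_i)
odds [] = []
odds (x ∷ xs) = x ∷ evens xs
evens [] = []
evens (x ∷ xs) = odds xs

IsProjFactSeq : ℕ → ℕ → List ℕ → Set
IsProjFactSeq m n s =
  All (1 <_) s × 2 ≤ length s × product (odds s) ≡ m × product (evens s) ≡ n

-- β(m) for odd m ≥ 3.
β : ℕ → ℕ
β m = if m % 4 ≡ᵇ 1
        then ((m ∸ 1) / 4) ! * ((m ∸ 1) / 4) !
        else ((m ∸ 3) / 4) ! * ((m + 1) / 4) !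

{-# OPTIONS --safe #-}

-- A factorization sequence x₁, x₂, x₃, … of (m, m) is read as the bases of a mixed
-- radix system for the numbers 0, …, m² − 1.  The digits in odd places give a row
-- value, those in even places a column value, and every number is t = ρ + γ for
-- exactly one pair (ρ, γ).  Distribute the row values over the rows and the column
-- values over the columns so that antipodal values sit at antipodal places, and
-- label a cell by t when its coordinates add up to an even number and by
-- m² − 1 − t otherwise: around every face the values cancel.  If moreover ranks and
-- positions have the same parity, then t is even exactly on the even cells, and
-- t may be halved, the labels of the even cells forming a block below or above
-- those of the odd cells: this gives two further families.
--
-- The label of the centre, which every symmetry fixes, tells the families apart.
-- Within a family a symmetry exchanging the axes is impossible, because only the row
-- values contain consecutive numbers, and the axis reflections are excluded by
-- putting a small rank first.  The order of the values then recovers the ranks,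
-- and the values recover the sequence.

module Submission where

open import Defs
open import Data.Nat using (ℕ; zero; suc; _+_; _*_; _∸_; _^_; _≤_; _<_; _%_; _!; _<?_; _≡ᵇ_; z≤n; s≤s; s≤s⁻¹; parity; ⌊_/2⌋; ⌈_/2⌉)
open import Data.Nat.DivMod using (_/_; m%n<n; 0/n≡0; m<n*o⇒m/o<n; m*n/n≡m; [m+kn]%n≡m%n; m≡m%n+[m/n]*n)
open import Data.Nat.ListAction using (product)
import Data.Nat.Properties as ℕ
open import Data.Nat.Tactic.RingSolver using (solve-∀)
open import Data.Bool using (Bool; true; false; not; _xor_; if_then_else_)
open import Data.Bool.Properties using (not-distribˡ-xor)
open import Data.Fin using (Fin; zero; suc; toℕ; fromℕ<; opposite; punchIn; splitAt; join; combine; remQuot; _↑ˡ_; _↑ʳ_; _≟_)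
open import Data.Fin.Properties using (any?; injective⇒≤; toℕ<n; toℕ-fromℕ<; fromℕ<-toℕ; toℕ-injective; toℕ-↑ˡ; toℕ-↑ʳ; punchIn-injective; punchInᵢ≢i; punchOut-injective; opposite-prop; opposite-involutive; splitAt-↑ˡ; splitAt-↑ʳ; join-splitAt; combine-remQuot; *↔×; +↔⊎; 1↔⊤; 2↔Bool)
open import Data.List using (List; []; _∷_; length; tabulate) renaming (lookup to lookupᴸ)
open import Data.List.Properties using (length-tabulate)
open import Data.List.Membership.Propositional using (_∈_)
open import Data.List.Membership.Propositional.Properties using (∈-lookup)
open import Data.List.Relation.Unary.All as All using (All; []; _∷_)
open import Data.List.Relation.Unary.AllPairs using (AllPairs; _∷_)
open import Data.List.Relation.Unary.AllPairs.Properties using (tabulate⁺)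
open import Data.List.Relation.Unary.Unique.Propositional using (Unique)
open import Data.Parity.Base using (Parity; 0ℙ; 1ℙ; _⁻¹) renaming (_+_ to _+ℙ_; _*_ to _*ℙ_)
import Data.Parity.Properties as ℙ
open import Data.Product using (_×_; _,_; proj₁; proj₂; Σ; ∃; uncurry)
open import Data.Product.Function.NonDependent.Propositional using (_×-↣_)
open import Data.Sum using (_⊎_; inj₁; inj₂)
open import Data.Sum.Function.Propositional using (_⊎-↣_)
open import Data.Sum.Properties using (inj₁-injective; inj₂-injective)
open import Data.Unit using (⊤)
open import Data.Vec using (Vec; []; _∷_; lookup)
open import Data.Vec.Properties using (tabulate∘lookup; tabulate-cong)
open import Algebra.Properties.CommutativeSemigroup ℕ.+-commutativeSemigroup using (interchange)
open import Function using (_∘_; Injective; Bijective; _⇔_; _↣_; mk↣; Injection; Equivalence)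
open import Function.Construct.Composition using (_↣-∘_)
open import Function.Construct.Identity using (↣-id)
open import Function.Properties.Inverse using (↔⇒↣)
open import Relation.Binary.Definitions using (tri<; tri≈; tri>)
open import Relation.Binary.PropositionalEquality using (_≡_; _≢_; _≗_; refl; sym; trans; cong; cong₂; subst; subst₂; module ≡-Reasoning)
open import Relation.Nullary using (¬_; contradiction; yes; no)

-- Mixed radix tilings

-- The functions call each other because dropping the first factor makes the next one, a column
-- factor, the leading row factor. A rank is expanded in the factors of its own axis, but each digit
-- is weighted by all preceding factors of both axes. The value at a factor `zero` is arbitrary.
rowVal colVal : List ℕ → ℕ → ℕ
rowVal []          _ = 0
rowVal (zero  ∷ _) _ = 0
rowVal (suc x ∷ s) r = r % suc x + suc x * colVal s (r / suc x)
colVal []      _ = 0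
colVal (x ∷ s) r = x * rowVal s r

rows cols : List ℕ → ℕ
rows s = product (odds s)
cols s = product (evens s)

digits-< : ∀ {x d d′ q q′} → d < x → q < q′ → d + x * q < d′ + x * q′
digits-< {x} {d} {d′} {q} {q′} d<x q<q′ = begin-strict
  d + x * q   <⟨ ℕ.+-monoˡ-< (x * q) d<x ⟩
  x + x * q   ≡⟨ ℕ.*-suc x q ⟨
  x * suc q   ≤⟨ ℕ.*-monoʳ-≤ x q<q′ ⟩
  x * q′      ≤⟨ ℕ.m≤n+m (x * q′) d′ ⟩
  d′ + x * q′ ∎
  where open ℕ.≤-Reasoning

digits-unique : ∀ {x d d′ q q′} → d < x → d′ < x → d + x * q ≡ d′ + x * q′ → d ≡ d′ × q ≡ q′
digits-unique {x} {d} {d′} {q} {q′} d<x d′<x eq with ℕ.<-cmp q q′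
... | tri< q<q′ _ _ = contradiction eq (ℕ.<⇒≢ (digits-< d<x q<q′))
... | tri> _ _ q′<q = contradiction (sym eq) (ℕ.<⇒≢ (digits-< d′<x q′<q))
... | tri≈ _ refl _ = ℕ.+-cancelʳ-≡ (x * q) d d′ eq , refl

-- Matching `r≡low+high` with `refl` replaces a rank by its expansion, so the inductions never
-- handle `_%_` and `_/_`.
record Digits (x Q r : ℕ) : Set where
  constructor mkDigits
  field
    low high   : ℕ
    low<       : low < x
    high<      : high < Q
    r≡low+high : r ≡ low + x * high

digits : ∀ x Q r → r < suc x * Q → Digits (suc x) Q r
digits x Q r r< = mkDigits (r % suc x) (r / suc x) (m%n<n r (suc x))
  (m<n*o⇒m/o<n (subst (r <_) (ℕ.*-comm (suc x) Q) r<))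
  (trans (m≡m%n+[m/n]*n r (suc x)) (cong (r % suc x +_) (ℕ.*-comm (r / suc x) (suc x))))

rowVal-digits : ∀ x s {d} q → d < suc x → rowVal (suc x ∷ s) (d + suc x * q) ≡ d + suc x * colVal s q
rowVal-digits x s {d} q d<x =
  cong₂ (λ d′ q′ → d′ + suc x * colVal s q′) (proj₁ same) (proj₂ same)
  where
  r = d + suc x * q
  same : r % suc x ≡ d × r / suc x ≡ q
  same = digits-unique (m%n<n r (suc x)) d<x
    (sym (trans (m≡m%n+[m/n]*n r (suc x)) (cong (r % suc x +_) (ℕ.*-comm (r / suc x) (suc x)))))

rowVal-zero : ∀ s → rowVal s 0 ≡ 0
colVal-zero : ∀ s → colVal s 0 ≡ 0
rowVal-zero []          = refl
rowVal-zero (zero  ∷ s) = refl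
rowVal-zero (suc x ∷ s) = trans (cong (λ q → suc x * colVal s q) (0/n≡0 (suc x)))
                         (trans (cong (suc x *_) (colVal-zero s)) (ℕ.*-zeroʳ (suc x)))
colVal-zero []      = refl
colVal-zero (x ∷ s) = trans (cong (x *_) (rowVal-zero s)) (ℕ.*-zeroʳ x)

rowVal-one : ∀ {s} → All (1 <_) s → 1 < rows s → rowVal s 1 ≡ 1
rowVal-one {[]}        _ (s≤s ())
rowVal-one {suc x ∷ s} (1<x ∷ _) _ = begin
  rowVal (suc x ∷ s) 1               ≡⟨ cong (λ r → rowVal (suc x ∷ s) (1 + r)) (ℕ.*-zeroʳ (suc x)) ⟨
  rowVal (suc x ∷ s) (1 + suc x * 0) ≡⟨ rowVal-digits x s 0 1<x ⟩
  1 + suc x * colVal s 0             ≡⟨ cong (λ c → 1 + suc x * c) (colVal-zero s) ⟩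
  1 + suc x * 0                      ≡⟨ cong (1 +_) (ℕ.*-zeroʳ (suc x)) ⟩
  1                                  ∎
  where open ≡-Reasoning

-- The high parts decide, by induction on the factors; if they agree, the low digits do.
rowVal-mono : ∀ {s r r′} → All (1 <_) s → r < r′ → r′ < rows s → rowVal s r < rowVal s r′
colVal-mono : ∀ {s r r′} → All (1 <_) s → r < r′ → r′ < cols s → colVal s r < colVal s r′
rowVal-mono {[]} _ (s≤s z≤n) (s≤s ())
rowVal-mono {suc x ∷ s} {r} {r′} (_ ∷ big) r<r′ r′<
  with digits x (cols s) r (ℕ.<-trans r<r′ r′<) | digits x (cols s) r′ r′<
... | mkDigits d q d< q< refl | mkDigits d′ q′ d′< q′< refl
  rewrite rowVal-digits x s q d< | rowVal-digits x s q′ d′< with ℕ.<-cmp q q′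
... | tri< q<q′ _ _ = digits-< {d′ = d′} d< (colVal-mono big q<q′ q′<)
... | tri> _ _ q′<q = contradiction (ℕ.<-trans r<r′ (digits-< {d′ = d} d′< q′<q)) (ℕ.<-irrefl refl)
... | tri≈ _ refl _ = ℕ.+-monoˡ-< _ (ℕ.+-cancelʳ-< (suc x * q) d d′ r<r′)
colVal-mono {[]} _ (s≤s z≤n) (s≤s ())
colVal-mono {suc x ∷ s} (_ ∷ big) r<r′ r′< = ℕ.*-monoʳ-< (suc x) (rowVal-mono big r<r′ r′<)

regroup : ∀ x d A B → d + x * B + x * A ≡ d + x * (A + B)
regroup = solve-∀

rows*cols-∷ : ∀ x s → rows (x ∷ s) * cols (x ∷ s) ≡ x * (rows s * cols s)
rows*cols-∷ x s = trans (ℕ.*-assoc x (cols s) (rows s)) (cong (x *_) (ℕ.*-comm (cols s) (rows s)))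

-- Splitting r = d + x * q leaves d + x * (`rowVal s c + colVal s q`): the first factor is peeled
-- off and the coordinates change places. Injectivity and the complement law below follow the same
-- recursion.
rowVal+colVal-bound : ∀ {s r c} → All (1 <_) s → r < rows s → c < cols s →
                      rowVal s r + colVal s c < rows s * cols s
rowVal+colVal-bound {[]} _ _ _ = s≤s z≤n
rowVal+colVal-bound {suc x ∷ s} {r} {c} (_ ∷ big) r< c< with digits x (cols s) r r<
... | mkDigits d q d< q< refl
  rewrite rowVal-digits x s q d< | regroup (suc x) d (rowVal s c) (colVal s q) | rows*cols-∷ (suc x) s =
  digits-< {d′ = 0} d< (rowVal+colVal-bound big c< q<)

rowVal+colVal-injective : ∀ {s r c r′ c′} → All (1 <_) s →
  r < rows s → c < cols s → r′ < rows s → c′ < cols s →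
  rowVal s r + colVal s c ≡ rowVal s r′ + colVal s c′ → r ≡ r′ × c ≡ c′
rowVal+colVal-injective {[]} _ (s≤s z≤n) (s≤s z≤n) (s≤s z≤n) (s≤s z≤n) _ = refl , refl
rowVal+colVal-injective {suc x ∷ s} {r} {c} {r′} {c′} (_ ∷ big) r< c< r′< c′< eq
  with digits x (cols s) r r< | digits x (cols s) r′ r′<
... | mkDigits d q d< q< refl | mkDigits d′ q′ d′< q′< refl
  rewrite rowVal-digits x s q d< | rowVal-digits x s q′ d′<
        | regroup (suc x) d (rowVal s c) (colVal s q) | regroup (suc x) d′ (rowVal s c′) (colVal s q′)
  with digits-unique d< d′< eq
... | refl , eq′ with rowVal+colVal-injective big c< q< c′< q′< eq′
... | refl , refl = refl , refl

-- In mixed radix notation r ↦ P ∸ 1 ∸ r complements every digit.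
digits-complement : ∀ {x Q d q d′ q′} → d < x → d′ < x → q < Q →
  suc (d + x * q + (d′ + x * q′)) ≡ x * Q → suc (d + d′) ≡ x × suc (q + q′) ≡ Q
digits-complement {x} {Q} {d} {q} {d′} {q′} d< d′< q< eq
  with ℕ.m≤n⇒∃[o]m+o≡n d< | ℕ.m≤n⇒∃[o]m+o≡n q<
... | d″ , refl | q″ , refl
  with digits-unique {x = x} {d′} {d″} {q′} {q″} d′< (s≤s (ℕ.m≤n+m d″ d))
         (ℕ.+-cancelˡ-≡ (d + x * q) _ _ (ℕ.suc-injective (trans eq (lemma d d″ q q″))))
  where
  lemma : ∀ d d″ q q″ → (suc d + d″) * (suc q + q″) ≡ suc (d + (suc d + d″) * q + (d″ + (suc d + d″) * q″))
  lemma = solve-∀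
... | refl , refl = refl , refl

-- Complementing both ranks complements every digit of the value. Grouping the sum by axis later
-- shows that antipodal row values have a constant sum, and likewise antipodal column values.
rowVal+colVal-complement : ∀ {s r r′ c c′} → All (1 <_) s →
  suc (r + r′) ≡ rows s → suc (c + c′) ≡ cols s →
  suc ((rowVal s r + rowVal s r′) + (colVal s c + colVal s c′)) ≡ rows s * cols s
rowVal+colVal-complement {[]} _ _ _ = refl
rowVal+colVal-complement {suc x ∷ s} {r} {r′} {c} {c′} (_ ∷ big) eqr eqc
  with digits x (cols s) r (ℕ.≤-trans (s≤s (ℕ.m≤m+n r r′)) (ℕ.≤-reflexive eqr))
     | digits x (cols s) r′ (ℕ.≤-trans (s≤s (ℕ.m≤n+m r′ r)) (ℕ.≤-reflexive eqr))
... | mkDigits d q d< q< refl | mkDigits d′ q′ d′< q′< refl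
  with digits-complement {q = q} {q′ = q′} d< d′< q< eqr
... | eqd , eqq rewrite rowVal-digits x s q d< | rowVal-digits x s q′ d′< = begin
  suc (d + X * colVal s q + (d′ + X * colVal s q′) + (X * rowVal s c + X * rowVal s c′))
    ≡⟨ lemma X d d′ (colVal s q) (colVal s q′) (rowVal s c) (rowVal s c′) ⟩
  suc (d + d′) + X * ((rowVal s c + rowVal s c′) + (colVal s q + colVal s q′))
    ≡⟨ cong (_+ X * ((rowVal s c + rowVal s c′) + (colVal s q + colVal s q′))) eqd ⟩
  X + X * ((rowVal s c + rowVal s c′) + (colVal s q + colVal s q′))
    ≡⟨ ℕ.*-suc X _ ⟨
  X * suc ((rowVal s c + rowVal s c′) + (colVal s q + colVal s q′))
    ≡⟨ cong (X *_) (rowVal+colVal-complement big eqc eqq) ⟩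
  X * (rows s * cols s)
    ≡⟨ rows*cols-∷ X s ⟨
  rows (X ∷ s) * cols (X ∷ s) ∎
  where
  open ≡-Reasoning
  X = suc x
  lemma : ∀ X d d′ a b e f → suc (d + X * a + (d′ + X * b) + (X * e + X * f))
                           ≡ suc (d + d′) + X * ((e + f) + (a + b))
  lemma = solve-∀

-- Parity of the values for odd factors

Odd : ℕ → Set
Odd n = parity n ≡ 1ℙ

*-oddˡ : ∀ m n → Odd (m * n) → Odd m
*-oddˡ m n eq with parity m | trans (sym (ℙ.*-homo-* m n)) eq
... | 1ℙ | _ = refl

*-oddʳ : ∀ m n → Odd (m * n) → Odd n
*-oddʳ m n eq = *-oddˡ n m (trans (cong parity (ℕ.*-comm n m)) eq)

entries-odd : ∀ s → Odd (rows s) → Odd (cols s) → All Odd s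
entries-odd []      _ _ = []
entries-odd (x ∷ s) o e = *-oddˡ x (cols s) o ∷ entries-odd s e (*-oddʳ x (cols s) o)

parity-odd-* : ∀ x n → Odd x → parity (x * n) ≡ parity n
parity-odd-* x n odd = trans (ℙ.*-homo-* x n) (cong (_*ℙ parity n) odd)

-- Odd place values are invisible modulo 2, so rank and value both have the parity of the sum of
-- their common digits.
rowVal-parity : ∀ {s r} → All (1 <_) s → All Odd s → r < rows s → parity (rowVal s r) ≡ parity r
colVal-parity : ∀ {s c} → All (1 <_) s → All Odd s → c < cols s → parity (colVal s c) ≡ parity c
rowVal-parity {[]} _ _ (s≤s z≤n) = refl
rowVal-parity {suc x ∷ s} {r} (_ ∷ big) (odd ∷ odds) r< with digits x (cols s) r r<
... | mkDigits d q d< q< refl rewrite rowVal-digits x s q d< = begin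
  parity (d + suc x * colVal s q)             ≡⟨ ℙ.+-homo-+ d _ ⟩
  parity d +ℙ parity (suc x * colVal s q)     ≡⟨ cong (parity d +ℙ_) (parity-odd-* (suc x) (colVal s q) odd) ⟩
  parity d +ℙ parity (colVal s q)             ≡⟨ cong (parity d +ℙ_) (colVal-parity big odds q<) ⟩
  parity d +ℙ parity q                        ≡⟨ cong (parity d +ℙ_) (parity-odd-* (suc x) q odd) ⟨
  parity d +ℙ parity (suc x * q)              ≡⟨ ℙ.+-homo-+ d _ ⟨
  parity (d + suc x * q)                      ∎
  where open ≡-Reasoning
colVal-parity {[]} _ _ (s≤s z≤n) = refl
colVal-parity {x ∷ s} {c} (_ ∷ big) (odd ∷ odds) c< =
  trans (parity-odd-* x (rowVal s c) odd) (rowVal-parity big odds c<)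

-- Recovering the sequence from the values

rows-pos : ∀ {s} → All (1 <_) s → 0 < rows s
cols-pos : ∀ {s} → All (1 <_) s → 0 < cols s
rows-pos []          = s≤s z≤n
rows-pos (x>1 ∷ big) = ℕ.*-mono-≤ (ℕ.<⇒≤ x>1) (cols-pos big)
cols-pos []          = s≤s z≤n
cols-pos (_ ∷ big)   = rows-pos big

head≤rows : ∀ {x s} → All (1 <_) (x ∷ s) → x ≤ rows (x ∷ s)
head≤rows {x} {s} (_ ∷ big) = subst (_≤ x * cols s) (ℕ.*-identityʳ x) (ℕ.*-monoʳ-≤ x (cols-pos big))

colVal-one>1 : ∀ {s} → All (1 <_) s → 1 < cols s → 1 < colVal s 1
colVal-one>1 []                    (s≤s ())
colVal-one>1 {x ∷ s} (x>1 ∷ big) 1<c = subst (1 <_)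
  (trans (sym (ℕ.*-identityʳ x)) (cong (x *_) (sym (rowVal-one big 1<c)))) x>1

-- The first digit overflows at x, where the row value jumps from x ∸ 1 past x.
rowVal-head : ∀ {x s} → All (1 <_) (x ∷ s) → x < rows (x ∷ s) → x < rowVal (x ∷ s) x
rowVal-head {suc x} {s} (x>1 ∷ big) x<P = subst (suc x <_)
  (trans (sym (rowVal-digits x s 1 (s≤s z≤n))) (cong (rowVal (suc x ∷ s)) (ℕ.*-identityʳ (suc x))))
  (subst (_< suc x * colVal s 1) (ℕ.*-identityʳ (suc x)) (ℕ.*-monoʳ-< (suc x) (colVal-one>1 big 1<c)))
  where
  1<c : 1 < cols s
  1<c = ℕ.*-cancelˡ-< (suc x) 1 (cols s) (subst (_< suc x * cols s) (sym (ℕ.*-identityʳ (suc x))) x<P)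

rowVal-below-head : ∀ {y s r} → r < y → rowVal (y ∷ s) r ≡ r
rowVal-below-head {suc y} {s} {r} r<y = begin
  rowVal (suc y ∷ s) r                ≡⟨ cong (rowVal (suc y ∷ s)) (r+0 r) ⟨
  rowVal (suc y ∷ s) (r + suc y * 0)  ≡⟨ rowVal-digits y s 0 r<y ⟩
  r + suc y * colVal s 0              ≡⟨ cong (λ c → r + suc y * c) (colVal-zero s) ⟩
  r + suc y * 0                       ≡⟨ r+0 r ⟩
  r                                   ∎
  where
  open ≡-Reasoning
  r+0 : ∀ r → r + suc y * 0 ≡ r
  r+0 r = trans (cong (r +_) (ℕ.*-zeroʳ (suc y))) (ℕ.+-identityʳ r)

-- At rank x the sequence with the smaller head has already overflowed, while the other still takes
-- the value x.
head-≮ : ∀ {x y s t} → All (1 <_) (x ∷ s) → All (1 <_) (y ∷ t) → rows (x ∷ s) ≡ rows (y ∷ t) →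
  (∀ r → r < rows (x ∷ s) → rowVal (x ∷ s) r ≡ rowVal (y ∷ t) r) → ¬ x < y
head-≮ {x} {y} {s} {t} bs bt eqP same x<y = ℕ.<-irrefl refl
  (subst (x <_) (trans (same x x<P) (rowVal-below-head x<y)) (rowVal-head bs x<P))
  where
  x<P : x < rows (x ∷ s)
  x<P = ℕ.<-≤-trans x<y (subst (y ≤_) (sym eqP) (head≤rows bt))

sequence-unique : ∀ {s t} → All (1 <_) s → All (1 <_) t → rows s ≡ rows t → cols s ≡ cols t →
  (∀ r → r < rows s → rowVal s r ≡ rowVal t r) → (∀ c → c < cols s → colVal s c ≡ colVal t c) → s ≡ t
sequence-unique {[]}    {[]}    _ _ _ _ _ _ = refl
sequence-unique {[]}    {y ∷ t} _ bt@(y>1 ∷ _) eqP _ _ _ =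
  contradiction (ℕ.<-≤-trans y>1 (subst (y ≤_) (sym eqP) (head≤rows bt))) (ℕ.<-irrefl refl)
sequence-unique {x ∷ s} {[]}    bs@(x>1 ∷ _) _ eqP _ _ _ =
  contradiction (ℕ.<-≤-trans x>1 (subst (x ≤_) eqP (head≤rows bs))) (ℕ.<-irrefl refl)
sequence-unique {x ∷ s} {y ∷ t} bs bt eqP eqQ same-row same-col with ℕ.<-cmp x y
... | tri< x<y _ _ = contradiction x<y (head-≮ bs bt eqP same-row)
... | tri> _ _ y<x = contradiction y<x (head-≮ bt bs (sym eqP)
  (λ r r< → sym (same-row r (subst (r <_) (sym eqP) r<))))
sequence-unique {suc x ∷ s} {_ ∷ t} (_ ∷ bs) (_ ∷ bt) eqP eqQ same-row same-col | tri≈ _ refl _ =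
  cong (suc x ∷_) (sequence-unique bs bt eqQ (ℕ.*-cancelˡ-≡ (cols s) (cols t) (suc x) eqP)
    -- The axes swap in the tail: its row values are the column values divided by the head, and its
    -- column values are the row values at multiples of the head, divided by the head.
    (λ r r< → ℕ.*-cancelˡ-≡ _ _ (suc x) (same-col r r<))
    (λ c c< → ℕ.*-cancelˡ-≡ _ _ (suc x)
      (trans (sym (rowVal-digits x s c (s≤s z≤n)))
      (trans (same-row (suc x * c) (ℕ.*-monoʳ-< (suc x) c<))
             (rowVal-digits x t c (s≤s z≤n))))))

-- Permutations and symmetric arrangements

-- Pigeonhole: a missed `y` could be punched out of the codomain, giving an injection from
-- `Fin (suc n)` into `Fin n`.
injective⇒surjective : ∀ {n} {f : Fin n → Fin n} → Injective _≡_ _≡_ f → ∀ y → ∃ λ x → f x ≡ y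
injective⇒surjective {suc n} {f} inj y with any? (λ x → f x ≟ y)
... | yes hit  = hit
... | no  miss = contradiction (injective⇒≤ (λ {i} {j} eq → inj (punchOut-injective (avoid i) (avoid j) eq))) ℕ.1+n≰n
  where
  avoid : ∀ x → y ≢ f x
  avoid x eq = miss (x , sym eq)

-- A permutation is coded by the image of `zero` and a code for the rest, fitted around that image
-- by `punchIn`. Codes are easily counted, and pointwise agreement of the permutations makes them
-- equal.
LehmerCode : ℕ → Set
LehmerCode zero    = ⊤
LehmerCode (suc n) = Fin (suc n) × LehmerCode n

perm : ∀ {n} → LehmerCode n → Fin n → Fin n
perm {suc n} (j , c) zero    = j
perm {suc n} (j , c) (suc i) = punchIn j (perm c i)

perm-injective : ∀ {n} (c : LehmerCode n) → Injective _≡_ _≡_ (perm c)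
perm-injective {suc n} (j , c) {zero}  {zero}   _  = refl
perm-injective {suc n} (j , c) {zero}  {suc i′} eq = contradiction (sym eq) (punchInᵢ≢i j _)
perm-injective {suc n} (j , c) {suc i} {zero}   eq = contradiction eq (punchInᵢ≢i j _)
perm-injective {suc n} (j , c) {suc i} {suc i′} eq = cong suc (perm-injective c (punchIn-injective j _ _ eq))

perm-determines : ∀ {n} (c c′ : LehmerCode n) → perm c ≗ perm c′ → c ≡ c′
perm-determines {zero}  _       _         _ = refl
perm-determines {suc n} (j , c) (j′ , c′) eq with eq zero
... | refl = cong (j ,_) (perm-determines c c′ (λ i → punchIn-injective j _ _ (eq (suc i))))

Fin!↣Code : ∀ n → Fin (n !) ↣ LehmerCode n
Fin!↣Code zero    = ↔⇒↣ 1↔⊤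
Fin!↣Code (suc n) = (↣-id _ ×-↣ Fin!↣Code n) ↣-∘ ↔⇒↣ (*↔× {suc n})

Fin2^↣Vec : ∀ n → Fin (2 ^ n) ↣ Vec Bool n
Fin2^↣Vec zero    = mk↣ {to = λ _ → []} (λ { {zero} {zero} _ → refl })
Fin2^↣Vec (suc n) =
  (mk↣ {to = uncurry _∷_} (λ { {_ , _} {_ , _} refl → refl }) ↣-∘ (↔⇒↣ 2↔Bool ×-↣ Fin2^↣Vec n))
  ↣-∘ ↔⇒↣ (*↔× {2})

-- inj₁ j stands for 2j and inj₂ j for 2j + 1.
deal : ∀ {n} → Fin n → Fin ⌈ n /2⌉ ⊎ Fin ⌊ n /2⌋
deal zero    = inj₁ zero
deal (suc i) with deal i
... | inj₁ j = inj₂ j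
... | inj₂ j = inj₁ (suc j)

undeal : ∀ {n} → Fin ⌈ n /2⌉ ⊎ Fin ⌊ n /2⌋ → Fin n
undeal {zero}  (inj₁ ())
undeal {zero}  (inj₂ ())
undeal {suc n} (inj₁ zero)    = zero
undeal {suc n} (inj₁ (suc j)) = suc (undeal (inj₂ j))
undeal {suc n} (inj₂ j)       = suc (undeal (inj₁ j))

undeal-deal : ∀ {n} (i : Fin n) → undeal (deal i) ≡ i
undeal-deal zero    = refl
undeal-deal (suc i) with deal i | undeal-deal i
... | inj₁ j | eq = cong suc eq
... | inj₂ j | eq = cong suc eq

deal-undeal : ∀ {n} (x : Fin ⌈ n /2⌉ ⊎ Fin ⌊ n /2⌋) → deal (undeal {n} x) ≡ x
deal-undeal {zero}  (inj₁ ())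
deal-undeal {zero}  (inj₂ ())
deal-undeal {suc n} (inj₁ zero) = refl
deal-undeal {suc n} (inj₁ (suc j)) with deal (undeal {n} (inj₂ j)) | deal-undeal {n} (inj₂ j)
... | _ | refl = refl
deal-undeal {suc n} (inj₂ j) with deal (undeal {n} (inj₁ j)) | deal-undeal {n} (inj₁ j)
... | _ | refl = refl

parity-next : ∀ {n m} → m ≡ suc n → parity m ≡ parity n ⁻¹
parity-next {n} refl = sym (ℙ.⁻¹-selfInverse (ℙ.suc-homo-⁻¹ n))

undeal-parity₁ : ∀ {n} j → parity (toℕ (undeal {n} (inj₁ j))) ≡ 0ℙ
undeal-parity₂ : ∀ {n} j → parity (toℕ (undeal {n} (inj₂ j))) ≡ 1ℙ
undeal-parity₁ {zero}  ()
undeal-parity₁ {suc n} zero    = refl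
undeal-parity₁ {suc n} (suc j) = trans (parity-next {toℕ (undeal {n} (inj₂ j))} refl) (cong _⁻¹ (undeal-parity₂ {n} j))
undeal-parity₂ {zero}  ()
undeal-parity₂ {suc n} j       = trans (parity-next {toℕ (undeal {n} (inj₁ j))} refl) (cong _⁻¹ (undeal-parity₁ {n} j))

-- Codes for the permutations that respect parity, one for the even and one for the odd elements.
-- For n = (m - 1) / 2 their number is `β m`.
PairCode : ℕ → Set
PairCode n = LehmerCode ⌈ n /2⌉ × LehmerCode ⌊ n /2⌋

permBoth : ∀ {n} → PairCode n → Fin ⌈ n /2⌉ ⊎ Fin ⌊ n /2⌋ → Fin ⌈ n /2⌉ ⊎ Fin ⌊ n /2⌋
permBoth (c , d) (inj₁ j) = inj₁ (perm c j)
permBoth (c , d) (inj₂ j) = inj₂ (perm d j)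

permBoth-injective : ∀ {n} (c : PairCode n) → Injective _≡_ _≡_ (permBoth {n} c)
permBoth-injective (c , d) {inj₁ _} {inj₁ _} eq = cong inj₁ (perm-injective c (inj₁-injective eq))
permBoth-injective (c , d) {inj₂ _} {inj₂ _} eq = cong inj₂ (perm-injective d (inj₂-injective eq))

parityPerm : ∀ {n} → PairCode n → Fin n → Fin n
parityPerm {n} c i = undeal (permBoth {n} c (deal i))

deal-injective : ∀ {n} → Injective _≡_ _≡_ (deal {n})
deal-injective {n} {i} {j} eq = trans (sym (undeal-deal i)) (trans (cong undeal eq) (undeal-deal j))

undeal-injective : ∀ {n} → Injective _≡_ _≡_ (undeal {n})
undeal-injective {n} {x} {y} eq = trans (sym (deal-undeal {n} x)) (trans (cong deal eq) (deal-undeal {n} y))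

parityPerm-injective : ∀ {n} (c : PairCode n) → Injective _≡_ _≡_ (parityPerm {n} c)
parityPerm-injective {n} c eq = deal-injective (permBoth-injective {n} c (undeal-injective {n} eq))

parityPerm-parity : ∀ {n} (c : PairCode n) i → parity (toℕ (parityPerm {n} c i)) ≡ parity (toℕ i)
parityPerm-parity {n} (c , d) i with deal i | undeal-deal i
... | inj₁ j | refl = trans (undeal-parity₁ {n} (perm c j)) (sym (undeal-parity₁ {n} j))
... | inj₂ j | refl = trans (undeal-parity₂ {n} (perm d j)) (sym (undeal-parity₂ {n} j))

parityPerm-determines : ∀ {n} (c c′ : PairCode n) → parityPerm {n} c ≗ parityPerm {n} c′ → c ≡ c′
parityPerm-determines {n} (c , d) (c′ , d′) eq = cong₂ _,_
  (perm-determines c c′ (λ j → inj₁-injective (both (inj₁ j))))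
  (perm-determines d d′ (λ j → inj₂-injective (both (inj₂ j))))
  where
  both : ∀ x → permBoth {n} (c , d) x ≡ permBoth {n} (c′ , d′) x
  both x with eq (undeal x)
  ... | eq′ rewrite deal-undeal {n} x = undeal-injective {n} eq′

opposite-sum : ∀ {n} (i : Fin n) → suc (toℕ i + toℕ (opposite i)) ≡ n
opposite-sum {n} i = trans (cong (suc (toℕ i) +_) (opposite-prop i)) (ℕ.m+[n∸m]≡n (toℕ<n i))

opposite-unique : ∀ {n} (i j : Fin n) → suc (toℕ i + toℕ j) ≡ n → j ≡ opposite i
opposite-unique i j eq = toℕ-injective (ℕ.+-cancelˡ-≡ (toℕ i) _ _ (ℕ.suc-injective (trans eq (sym (opposite-sum i)))))

module Arrangement (h : ℕ) where
  m : ℕ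
  m = h + suc h

  -- side false i is position i, side true i its mirror image 2h ∸ i.
  data Place : Set where
    centre : Place
    side   : Bool → Fin h → Place

  side-injective : ∀ {b c i j} → side b i ≡ side c j → b ≡ c × i ≡ j
  side-injective refl = refl , refl

  locate : Fin h ⊎ Fin (suc h) → Place
  locate (inj₁ i)       = side false i
  locate (inj₂ zero)    = centre
  locate (inj₂ (suc j)) = side true (opposite j)

  place : Fin m → Place
  place i = locate (splitAt h i)

  mid : Fin m
  mid = h ↑ʳ zero

  unplace : Place → Fin m
  unplace centre         = mid
  unplace (side false i) = i ↑ˡ suc h
  unplace (side true  i) = h ↑ʳ suc (opposite i)

  place-unplace : ∀ p → place (unplace p) ≡ p
  place-unplace centre         = cong locate (splitAt-↑ʳ h (suc h) zero)
  place-unplace (side false i) = cong locate (splitAt-↑ˡ h i (suc h))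
  place-unplace (side true i)  = trans (cong locate (splitAt-↑ʳ h (suc h) (suc (opposite i))))
                                       (cong (side true) (opposite-involutive i))

  unplace-locate : ∀ x → unplace (locate x) ≡ join h (suc h) x
  unplace-locate (inj₁ i)       = refl
  unplace-locate (inj₂ zero)    = refl
  unplace-locate (inj₂ (suc j)) = cong (λ k → h ↑ʳ suc k) (opposite-involutive j)

  unplace-place : ∀ i → unplace (place i) ≡ i
  unplace-place i = trans (unplace-locate (splitAt h i)) (join-splitAt h (suc h) i)

  flip : Place → Place
  flip centre     = centre
  flip (side b i) = side (not b) i

  unplace-side-sum : ∀ i → suc (toℕ (unplace (side false i)) + toℕ (unplace (side true i))) ≡ m
  unplace-side-sum i = begin
    suc (toℕ (i ↑ˡ suc h) + toℕ (h ↑ʳ suc (opposite i)))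
      ≡⟨ cong₂ (λ a b → suc (a + b)) (toℕ-↑ˡ i (suc h)) (toℕ-↑ʳ h (suc (opposite i))) ⟩
    suc (toℕ i + (h + suc (toℕ (opposite i))))
      ≡⟨ lemma (toℕ i) h (toℕ (opposite i)) ⟩
    h + suc (suc (toℕ i + toℕ (opposite i)))
      ≡⟨ cong (λ k → h + suc k) (opposite-sum i) ⟩
    h + suc h ∎
    where
    open ≡-Reasoning
    lemma : ∀ i h o → suc (i + (h + suc o)) ≡ h + suc (suc (i + o))
    lemma = solve-∀

  unplace-flip : ∀ p → unplace (flip p) ≡ opposite (unplace p)
  unplace-flip centre         = opposite-unique mid mid
    (trans (cong₂ (λ a b → suc (a + b)) mid≡h mid≡h) (sym (ℕ.+-suc h h)))
    where
    mid≡h : toℕ mid ≡ h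
    mid≡h = trans (toℕ-↑ʳ h (zero {h})) (ℕ.+-identityʳ h)
  unplace-flip (side false i) = opposite-unique _ _ (unplace-side-sum i)
  unplace-flip (side true  i) = opposite-unique _ _
    (trans (cong suc (ℕ.+-comm (toℕ (unplace (side true i))) _)) (unplace-side-sum i))

  opposite-mid : opposite mid ≡ mid
  opposite-mid = sym (unplace-flip centre)

  place-opposite : ∀ i → place (opposite i) ≡ flip (place i)
  place-opposite i = begin
    place (opposite i)                   ≡⟨ cong (place ∘ opposite) (unplace-place i) ⟨
    place (opposite (unplace (place i))) ≡⟨ cong place (unplace-flip (place i)) ⟨
    place (unplace (flip (place i)))     ≡⟨ place-unplace _ ⟩
    flip (place i)                       ∎
    where open ≡-Reasoning

  -- Since m = 2h + 1, a position and its mirror image add up to the even number 2h.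
  parity-opposite : ∀ (i : Fin m) → parity (toℕ (opposite i)) ≡ parity (toℕ i)
  parity-opposite i = cancel _ _ (begin
    parity (toℕ i) +ℙ parity (toℕ (opposite i)) ≡⟨ ℙ.+-homo-+ (toℕ i) _ ⟨
    parity (toℕ i + toℕ (opposite i))           ≡⟨ cong parity (ℕ.suc-injective (trans (opposite-sum i) (ℕ.+-suc h h))) ⟩
    parity (h + h)                              ≡⟨ ℙ.+-homo-+ h h ⟩
    parity h +ℙ parity h                        ≡⟨ ℙ.p+p≡0ℙ (parity h) ⟩
    0ℙ                                          ∎)
    where
    open ≡-Reasoning
    cancel : ∀ p q → p +ℙ q ≡ 0ℙ → q ≡ p
    cancel 0ℙ 0ℙ _ = refl
    cancel 1ℙ 1ℙ _ = refl

  side-parity : ∀ b i → parity (toℕ (unplace (side b i))) ≡ parity (toℕ i)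
  side-parity false i = cong parity (toℕ-↑ˡ i (suc h))
  side-parity true  i = trans (cong (parity ∘ toℕ) (unplace-flip (side false i)))
                       (trans (parity-opposite (unplace (side false i))) (side-parity false i))

  -- A signed permutation of the h antipodal pairs: `p` moves the pairs and `ε` says which of them
  -- are reversed.
  shuffle : (Fin h → Bool) → (Fin h → Fin h) → Place → Place
  shuffle ε p centre     = centre
  shuffle ε p (side b i) = side (b xor ε i) (p i)

  xor-cancelʳ : ∀ b c d → b xor d ≡ c xor d → b ≡ c
  xor-cancelʳ false false d     _  = refl
  xor-cancelʳ true  true  d     _  = refl
  xor-cancelʳ false true  false ()
  xor-cancelʳ false true  true  ()
  xor-cancelʳ true  false false ()
  xor-cancelʳ true  false true  ()

  shuffle-injective : ∀ ε {p} → Injective _≡_ _≡_ p → Injective _≡_ _≡_ (shuffle ε p)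
  shuffle-injective ε inj {centre}   {centre}   _ = refl
  shuffle-injective ε inj {side b i} {side c j} eq with side-injective eq
  ... | eqb , eqi with inj eqi
  ... | refl = cong (λ b → side b i) (xor-cancelʳ b c (ε i) eqb)

  shuffle-flip : ∀ ε p x → shuffle ε p (flip x) ≡ flip (shuffle ε p x)
  shuffle-flip ε p centre     = refl
  shuffle-flip ε p (side b i) = cong (λ b → side b (p i)) (sym (not-distribˡ-xor b (ε i)))

  arrange : (Fin h → Bool) → (Fin h → Fin h) → Fin m → Fin m
  arrange ε p i = unplace (shuffle ε p (place i))

  place-injective : Injective _≡_ _≡_ place
  place-injective {i} {j} eq = trans (sym (unplace-place i)) (trans (cong unplace eq) (unplace-place j))

  unplace-injective : Injective _≡_ _≡_ unplace
  unplace-injective {x} {y} eq = trans (sym (place-unplace x)) (trans (cong place eq) (place-unplace y))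

  arrange-injective : ∀ ε {p} → Injective _≡_ _≡_ p → Injective _≡_ _≡_ (arrange ε p)
  arrange-injective ε inj eq = place-injective (shuffle-injective ε inj (unplace-injective eq))

  arrange-opposite : ∀ ε p i → arrange ε p (opposite i) ≡ opposite (arrange ε p i)
  arrange-opposite ε p i = trans (cong (unplace ∘ shuffle ε p) (place-opposite i))
                          (trans (cong unplace (shuffle-flip ε p (place i))) (unplace-flip (shuffle ε p (place i))))

  arrange-mid : ∀ ε p → arrange ε p mid ≡ mid
  arrange-mid ε p = cong (unplace ∘ shuffle ε p) (place-unplace centre)

  arrange-parity : ∀ ε p → (∀ i → parity (toℕ (p i)) ≡ parity (toℕ i)) →
                   ∀ i → parity (toℕ (arrange ε p i)) ≡ parity (toℕ i)
  arrange-parity ε p pres i with place i | unplace-place i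
  ... | centre   | refl = refl
  ... | side b j | refl = trans (side-parity (b xor ε j) (p j)) (trans (pres j) (sym (side-parity b j)))

  -- The image of `side false i` alone reveals the sign and the destination of the i-th pair.
  arrange-determines : ∀ {ε ε′ p p′} → arrange ε p ≗ arrange ε′ p′ → ε ≗ ε′ × p ≗ p′
  arrange-determines {ε} {ε′} {p} {p′} eq = (λ i → proj₁ (same i)) , (λ i → proj₂ (same i))
    where
    same : ∀ i → ε i ≡ ε′ i × p i ≡ p′ i
    same i with eq (unplace (side false i))
    ... | eq′ rewrite place-unplace (side false i) = side-injective (unplace-injective eq′)

-- Face-magic labels

data Family : Set where
  plain lower upper : Family

-- In `plain` the labels are t + 1 and N - t. In `lower` the even values give t / 2 + 1, filling 1
-- to (N + 1) / 2, and the odd ones N - (t - 1) / 2, filling the rest. In `upper` they give (N + 1 +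
-- t) / 2 and (N - t) / 2, so the blocks change places.
scale evenShift oddTotal magicSum : Family → ℕ → ℕ
scale plain _ = 1
scale lower _ = 2
scale upper _ = 2
evenShift plain N = 1
evenShift lower N = 2
evenShift upper N = N + 1
oddTotal plain N = N
oddTotal lower N = 2 * N + 1
oddTotal upper N = N
magicSum plain N = 2 * N + 2
magicSum lower N = 2 * N + 3
magicSum upper N = 2 * N + 1

-- The label L of a cell of parity p on which the tiling takes the value t is
-- affine in t, with slope 1 / scale on even cells and −1 / scale on odd cells,
-- so that the values cancel around a face.
Labels : Family → ℕ → Parity → ℕ → ℕ → Set
Labels φ N 0ℙ t L = scale φ N * L ≡ t + evenShift φ N
Labels φ N 1ℙ t L = scale φ N * L + t ≡ oddTotal φ N

even-half : ∀ n → parity n ≡ 0ℙ → ∃ λ u → n ≡ u + u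
even-half zero          _  = 0 , refl
even-half (suc (suc n)) eq with even-half n eq
... | u , refl = suc u , cong suc (sym (ℕ.+-suc u u))

odd-half : ∀ n → parity n ≡ 1ℙ → ∃ λ u → n ≡ suc (u + u)
odd-half (suc zero)    _  = 0 , refl
odd-half (suc (suc n)) eq with odd-half n eq
... | u , refl = suc u , cong (λ n → suc (suc n)) (sym (ℕ.+-suc u u))

double-cancel-≤ : ∀ u v → u + u ≤ v + v → u ≤ v
double-cancel-≤ u v le = ℕ.≮⇒≥ λ v<u → ℕ.<-irrefl refl (ℕ.<-≤-trans (ℕ.+-mono-< v<u v<u) le)

label-ℕ : ∀ φ {N t} p → Odd N → t < N → (φ ≢ plain → parity t ≡ p) →
          ∃ λ ℓ → ℓ < N × Labels φ N p t (suc ℓ)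
label-ℕ plain {N} {t} 0ℙ _ t<N _ = t , t<N , trans (ℕ.*-identityˡ (suc t)) (ℕ.+-comm 1 t)
label-ℕ plain {N} {t} 1ℙ _ t<N _ with ℕ.m≤n⇒∃[o]m+o≡n t<N
... | w , refl = w , s≤s (ℕ.m≤n+m w t) , lemma w t
  where
  lemma : ∀ w t → 1 * suc w + t ≡ suc (t + w)
  lemma = solve-∀
label-ℕ lower {N} {t} 0ℙ _ t<N par with even-half t (par λ ())
... | u , refl = u , ℕ.≤-<-trans (ℕ.m≤m+n u u) t<N , lemma u
  where
  lemma : ∀ u → 2 * suc u ≡ u + u + 2
  lemma = solve-∀
label-ℕ lower {N} {t} 1ℙ _ t<N par with odd-half t (par λ ())
-- As u ≤ t < N, the label N - u = w + 1 is positive.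
... | u , refl with ℕ.m≤n⇒∃[o]m+o≡n (ℕ.≤-<-trans (ℕ.m≤n+m u (suc u)) t<N)
...   | w , refl = w , s≤s (ℕ.m≤n+m w u) , lemma u w
  where
  lemma : ∀ u w → 2 * suc w + suc (u + u) ≡ 2 * suc (u + w) + 1
  lemma = solve-∀
label-ℕ upper {N} {t} 0ℙ oddN t<N par with even-half t (par λ ()) | odd-half N oddN
-- With N = 2v + 1 the label (N + 1 + t) / 2 is v + u + 1, and u ≤ v keeps it within N.
... | u , refl | v , refl = v + u , s≤s (ℕ.+-monoʳ-≤ v (double-cancel-≤ u v (s≤s⁻¹ t<N))) , lemma u v
  where
  lemma : ∀ u v → 2 * suc (v + u) ≡ u + u + (suc (v + v) + 1)
  lemma = solve-∀
label-ℕ upper {N} {t} 1ℙ oddN t<N par with odd-half t (par λ ()) | odd-half N oddN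
-- With N = 2v + 1 and t = 2u + 1 the label (N - t) / 2 is v - u = w + 1.
... | u , refl | v , refl with ℕ.m≤n⇒∃[o]m+o≡n u<v
  where
  u<v : u < v
  u<v = ℕ.≰⇒> λ v≤u → ℕ.<-irrefl refl (ℕ.<-≤-trans t<N (s≤s (ℕ.+-mono-≤ v≤u v≤u)))
...   | w , refl = w , s≤s (ℕ.m≤n⇒m≤n+o _ (ℕ.m≤n+m w (suc u))) , lemma u w
  where
  lemma : ∀ u w → 2 * suc w + suc (u + u) ≡ suc (suc u + w + (suc u + w))
  lemma = solve-∀

label : ∀ φ {N t} p → Odd N → t < N → (φ ≢ plain → parity t ≡ p) →
        ∃ λ (ℓ : Fin N) → Labels φ N p t (suc (toℕ ℓ))
label φ {N} {t} p oddN t<N par with label-ℕ φ p oddN t<N par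
... | ℓ , ℓ<N , ok = fromℕ< ℓ<N , subst (Labels φ N p t ∘ suc) (sym (toℕ-fromℕ< ℓ<N)) ok

Labels-injective : ∀ φ {N} p {t t′ L} → Labels φ N p t L → Labels φ N p t′ L → t ≡ t′
Labels-injective φ {N} 0ℙ {t} {t′} {L} eq eq′ = ℕ.+-cancelʳ-≡ (evenShift φ N) t t′ (trans (sym eq) eq′)
Labels-injective φ {N} 1ℙ {t} {t′} {L} eq eq′ = ℕ.+-cancelˡ-≡ (scale φ N * L) t t′ (trans eq (sym eq′))

-- Eliminating the common label leaves an equation between t and t′. In the halved families it is
-- impossible, their two blocks of labels being disjoint; in `plain` it says that the values are
-- complementary.
Labels-mixed : ∀ φ {N t t′ L} → Labels φ N 0ℙ t L → Labels φ N 1ℙ t′ L → t < N → t′ < N → suc (t + t′) ≡ N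
Labels-mixed φ {N} {t} {t′} {L} eq eq′ t<N t′<N = go φ (trans (cong (_+ t′) (sym eq)) eq′)
  where
  go : ∀ φ → t + evenShift φ N + t′ ≡ oddTotal φ N → suc (t + t′) ≡ N
  go plain e = trans (lemma t t′) e
    where
    lemma : ∀ t t′ → suc (t + t′) ≡ t + 1 + t′
    lemma = solve-∀
  go lower e = contradiction (trans (lemma t t′) e) (ℕ.<⇒≢ (begin-strict
    suc t + suc t′ ≤⟨ ℕ.+-mono-≤ t<N t′<N ⟩
    N + N          <⟨ ℕ.n<1+n (N + N) ⟩
    suc (N + N)    ≡⟨ lemma′ N ⟩
    2 * N + 1      ∎))
    where
    open ℕ.≤-Reasoning
    lemma : ∀ t t′ → suc t + suc t′ ≡ t + 2 + t′
    lemma = solve-∀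
    lemma′ : ∀ N → suc (N + N) ≡ 2 * N + 1
    lemma′ = solve-∀
  go upper e = contradiction (trans (sym e) (lemma t t′ N)) (ℕ.<⇒≢ (s≤s (ℕ.m≤n+m N (t + t′))))
    where
    lemma : ∀ t t′ N → t + (N + 1) + t′ ≡ suc (t + t′ + N)
    lemma = solve-∀

scale-cancel : ∀ φ {N} L L′ → scale φ N * L ≡ scale φ N * L′ → L ≡ L′
scale-cancel plain L L′ = ℕ.*-cancelˡ-≡ L L′ 1
scale-cancel lower L L′ = ℕ.*-cancelˡ-≡ L L′ 2
scale-cancel upper L L′ = ℕ.*-cancelˡ-≡ L L′ 2

scale-magicSum : ∀ φ N → scale φ N * magicSum φ N ≡ (evenShift φ N + evenShift φ N) + (oddTotal φ N + oddTotal φ N)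
scale-magicSum plain = lemma
  where
  lemma : ∀ N → 1 * (2 * N + 2) ≡ (1 + 1) + (N + N)
  lemma = solve-∀
scale-magicSum lower = lemma
  where
  lemma : ∀ N → 2 * (2 * N + 3) ≡ (2 + 2) + ((2 * N + 1) + (2 * N + 1))
  lemma = solve-∀
scale-magicSum upper = lemma
  where
  lemma : ∀ N → 2 * (2 * N + 1) ≡ ((N + 1) + (N + 1)) + (N + N)
  lemma = solve-∀

-- Adding t₂ + t₃ completes each scaled odd label to the constant `oddTotal φ N`; the even labels
-- contribute the equal sum t₁ + t₄, which then cancels.
quad-even : ∀ φ {N t₁ t₂ t₃ t₄ L₁ L₂ L₃ L₄} →
  Labels φ N 0ℙ t₁ L₁ → Labels φ N 1ℙ t₂ L₂ → Labels φ N 1ℙ t₃ L₃ → Labels φ N 0ℙ t₄ L₄ →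
  t₁ + t₄ ≡ t₂ + t₃ → sum4 L₁ L₂ L₃ L₄ ≡ magicSum φ N
quad-even φ {N} {t₁} {t₂} {t₃} {t₄} {L₁} {L₂} {L₃} {L₄} e₁ e₂ e₃ e₄ eq =
  scale-cancel φ {N} _ _ (trans (ℕ.+-cancelʳ-≡ (t₂ + t₃) _ _ (begin
    d * sum4 L₁ L₂ L₃ L₄ + (t₂ + t₃)                      ≡⟨ expand d L₁ L₂ L₃ L₄ t₂ t₃ ⟩
    (d * L₁ + d * L₄) + ((d * L₂ + t₂) + (d * L₃ + t₃))   ≡⟨ cong₂ _+_ (cong₂ _+_ e₁ e₄) (cong₂ _+_ e₂ e₃) ⟩
    ((t₁ + c) + (t₄ + c)) + (o + o)                       ≡⟨ gather t₁ t₄ c o ⟩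
    ((c + c) + (o + o)) + (t₁ + t₄)                       ≡⟨ cong (((c + c) + (o + o)) +_) eq ⟩
    ((c + c) + (o + o)) + (t₂ + t₃)                       ∎)) (sym (scale-magicSum φ N)))
  where
  open ≡-Reasoning
  d = scale φ N
  c = evenShift φ N
  o = oddTotal φ N
  expand : ∀ d L₁ L₂ L₃ L₄ t₂ t₃ → d * (L₁ + L₂ + L₃ + L₄) + (t₂ + t₃)
                                 ≡ (d * L₁ + d * L₄) + ((d * L₂ + t₂) + (d * L₃ + t₃))
  expand = solve-∀
  gather : ∀ t₁ t₄ c o → ((t₁ + c) + (t₄ + c)) + (o + o) ≡ ((c + c) + (o + o)) + (t₁ + t₄)
  gather = solve-∀

quad : ∀ φ {N} p {t₁ t₂ t₃ t₄ L₁ L₂ L₃ L₄} →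
  Labels φ N p t₁ L₁ → Labels φ N (p ⁻¹) t₂ L₂ → Labels φ N (p ⁻¹) t₃ L₃ → Labels φ N p t₄ L₄ →
  t₁ + t₄ ≡ t₂ + t₃ → sum4 L₁ L₂ L₃ L₄ ≡ magicSum φ N
quad φ 0ℙ e₁ e₂ e₃ e₄ eq = quad-even φ e₁ e₂ e₃ e₄ eq
quad φ 1ℙ {L₁ = L₁} {L₂} {L₃} {L₄} e₁ e₂ e₃ e₄ eq =
  trans (lemma L₁ L₂ L₃ L₄) (quad-even φ e₂ e₁ e₄ e₃ (sym eq))
  where
  lemma : ∀ a b c d → a + b + c + d ≡ b + a + d + c
  lemma = solve-∀

vertex-injective⇒bijective : ∀ {m n} {f : Vertex m n → Fin (m * n)} → Injective _≡_ _≡_ f → Bijective _≡_ _≡_ f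
vertex-injective⇒bijective {m} {n} {f} inj = inj , surj
  where
  flat-injective : Injective _≡_ _≡_ (f ∘ remQuot {m} n)
  flat-injective {i} {j} eq = trans (sym (combine-remQuot {m} n i))
    (trans (cong (λ v → combine (proj₁ v) (proj₂ v)) (inj eq)) (combine-remQuot {m} n j))
  surj : ∀ y → ∃ λ v → ∀ {w} → w ≡ v → f w ≡ y
  surj y with injective⇒surjective flat-injective y
  ... | x , fx≡y = remQuot {m} n x , λ { refl → fx≡y }

lab-toℕ : ∀ {m n} (f : Vertex m n → Fin (m * n)) i j → lab f (toℕ i) (toℕ j) ≡ suc (toℕ (f (i , j)))
lab-toℕ {m} {n} f i j with toℕ i <? m | toℕ j <? n
... | yes p | yes q = cong₂ (λ i j → suc (toℕ (f (i , j)))) (fromℕ<-toℕ i p) (fromℕ<-toℕ j q)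
... | no ¬p | _     = contradiction (toℕ<n i) ¬p
... | yes _ | no ¬q = contradiction (toℕ<n j) ¬q

cell : ∀ {m n} → Vertex m n → Parity
cell (i , j) = parity (toℕ i) +ℙ parity (toℕ j)

⁻¹-+ˡ : ∀ p q → (p ⁻¹) +ℙ q ≡ (p +ℙ q) ⁻¹
⁻¹-+ˡ 0ℙ 0ℙ = refl
⁻¹-+ˡ 0ℙ 1ℙ = refl
⁻¹-+ˡ 1ℙ 0ℙ = refl
⁻¹-+ˡ 1ℙ 1ℙ = refl

⁻¹-+ʳ : ∀ p q → p +ℙ (q ⁻¹) ≡ (p +ℙ q) ⁻¹
⁻¹-+ʳ p q = trans (ℙ.+-comm p (q ⁻¹)) (trans (⁻¹-+ˡ q p) (cong _⁻¹ (ℙ.+-comm q p)))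

+-exchange : ∀ a a′ b b′ → (a + b) + (a′ + b′) ≡ (a′ + b) + (a + b′)
+-exchange = solve-∀

sum4-swap : ∀ a b c d → sum4 a b d c ≡ sum4 a b c d
sum4-swap a b c d = lemma a b c d
  where
  lemma : ∀ a b c d → a + b + d + c ≡ a + b + c + d
  lemma = solve-∀

-- Tilings and the labellings that realise them

module Labelling (k : ℕ) where
  open Arrangement (suc k) public

  record Tiling : Set where
    field
      ρ γ        : Fin m → ℕ
      bound      : ∀ i j → ρ i + γ j < m * m
      injective  : ∀ {i j i′ j′} → ρ i + γ j ≡ ρ i′ + γ j′ → i ≡ i′ × j ≡ j′
      complement : ∀ i j → suc ((ρ i + ρ (opposite i)) + (γ j + γ (opposite j))) ≡ m * m

    value : Vertex m m → ℕ
    value (i , j) = ρ i + γ j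

    value-opposite : ∀ i j → suc (value (i , j) + value (opposite i , opposite j)) ≡ m * m
    value-opposite i j = trans (cong suc (interchange (ρ i) (γ j) (ρ (opposite i)) (γ (opposite j)))) (complement i j)

    -- In `complement` the column can be frozen anywhere, here at `mid`. The constant sums balance
    -- the faces that cross the boundary.
    ρ-complement : ∀ i i′ → ρ i + ρ (opposite i) ≡ ρ i′ + ρ (opposite i′)
    ρ-complement i i′ = ℕ.+-cancelʳ-≡ (γ mid + γ (opposite mid)) _ _ (ℕ.suc-injective (trans (complement i mid) (sym (complement i′ mid))))

    γ-complement : ∀ j j′ → γ j + γ (opposite j) ≡ γ j′ + γ (opposite j′)
    γ-complement j j′ = ℕ.+-cancelˡ-≡ (ρ mid + ρ (opposite mid)) _ _ (ℕ.suc-injective (trans (complement mid j) (sym (complement mid j′))))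

  cell-opposite : ∀ i j → cell {m} {m} (opposite i , opposite j) ≡ cell (i , j)
  cell-opposite i j = cong₂ _+ℙ_ (parity-opposite i) (parity-opposite j)

  Realises : Family → Tiling → (Vertex m m → Fin (m * m)) → Set
  Realises φ t f = ∀ v → Labels φ (m * m) (cell v) (Tiling.value t v) (suc (toℕ (f v)))

  module _ {φ t f} (real : Realises φ t f) where
    open Tiling t

    -- Two cells of different parity sharing a label would carry complementary
    -- values, hence be antipodal; but antipodal cells have the same parity.
    ¬mixed : ∀ {v w} → cell v ≡ 0ℙ → cell w ≡ 1ℙ → f v ≢ f w
    ¬mixed {v@(i , j)} {w@(i′ , j′)} pv pw eq =
      contradiction (trans (sym pv) (trans (cong cell v≡opp) (trans (cell-opposite i′ j′) pw))) (λ ())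
      where
      sum : suc (value v + value w) ≡ m * m
      sum = Labels-mixed φ (subst (λ p → Labels φ (m * m) p (value v) (suc (toℕ (f v)))) pv (real v))
        (subst₂ (λ p ℓ → Labels φ (m * m) p (value w) (suc (toℕ ℓ))) pw (sym eq) (real w))
        (bound i j) (bound i′ j′)
      v≡opp : v ≡ (opposite i′ , opposite j′)
      v≡opp with injective {i} {j} {opposite i′} {opposite j′} (ℕ.+-cancelˡ-≡ (value w) _ _
        (ℕ.suc-injective (trans (cong suc (ℕ.+-comm (value w) (value v))) (trans sum (sym (value-opposite i′ j′))))))
      ... | refl , refl = refl

    realises-injective : Injective _≡_ _≡_ f
    realises-injective {v@(i , j)} {w@(i′ , j′)} eq = by (cell v) (cell w) refl refl
      where
      same : cell v ≡ cell w → v ≡ w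
      same pvw with injective {i} {j} {i′} {j′} (Labels-injective φ (cell v) (real v)
        (subst₂ (λ p ℓ → Labels φ (m * m) p (value w) (suc (toℕ ℓ))) (sym pvw) (sym eq) (real w)))
      ... | refl , refl = refl
      by : ∀ p q → cell v ≡ p → cell w ≡ q → v ≡ w
      by 0ℙ 0ℙ pv pw = same (trans pv (sym pw))
      by 0ℙ 1ℙ pv pw = contradiction eq (¬mixed pv pw)
      by 1ℙ 0ℙ pv pw = contradiction (sym eq) (¬mixed pw pv)
      by 1ℙ 1ℙ pv pw = same (trans pv (sym pw))

    labels-at : ∀ {a b p} i j → toℕ i ≡ a → toℕ j ≡ b → cell (i , j) ≡ p →
                Labels φ (m * m) p (ρ i + γ j) (lab f a b)
    labels-at i j refl refl refl = subst (Labels φ (m * m) _ (value (i , j))) (sym (lab-toℕ f i j)) (real (i , j))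

    toℕ-opposite-suc : ∀ (i : Fin m) {a} → toℕ i ≡ suc a → toℕ (opposite i) ≡ m ∸ 2 ∸ a
    toℕ-opposite-suc i {a} eq = trans (opposite-prop i)
      (trans (cong (λ x → m ∸ suc x) eq) (sym (ℕ.∸-+-assoc (m ∸ 1) 1 a)))

    module Step {a} (sa<m : suc a < m) where
      a<m : a < m
      a<m = ℕ.<-trans (ℕ.n<1+n a) sa<m
      i i′ : Fin m
      i  = fromℕ< a<m
      i′ = fromℕ< sa<m
      i≡  : toℕ i ≡ a
      i≡  = toℕ-fromℕ< a<m
      i′≡ : toℕ i′ ≡ suc a
      i′≡ = toℕ-fromℕ< sa<m
      o≡  : toℕ (opposite i) ≡ m ∸ 1 ∸ a
      o≡  = trans (opposite-prop i) (cong (λ x → m ∸ suc x) i≡)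
      o′≡ : toℕ (opposite i′) ≡ m ∸ 2 ∸ a
      o′≡ = toℕ-opposite-suc i′ i′≡
      flip-parity : parity (toℕ i′) ≡ parity (toℕ i) ⁻¹
      flip-parity = parity-next (trans i′≡ (cong suc (sym i≡)))

    last : Fin m
    last = opposite zero

    last≡ : toℕ last ≡ m ∸ 1
    last≡ = opposite-prop {m} zero

    realises-magic : IsFaceMagic m m f
    realises-magic = magicSum φ (m * m) , inner , sideways , upwards
      where
      inner : ∀ a b → suc a < m → suc b < m →
        sum4 (lab f a b) (lab f (suc a) b) (lab f a (suc b)) (lab f (suc a) (suc b)) ≡ magicSum φ (m * m)
      inner a b a< b< = quad φ (cell (A.i , B.i))
        (labels-at A.i  B.i  A.i≡  B.i≡  refl)
        (labels-at A.i′ B.i  A.i′≡ B.i≡  (trans (cong (_+ℙ _) A.flip-parity) (⁻¹-+ˡ (parity (toℕ A.i)) (parity (toℕ B.i)))))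
        (labels-at A.i  B.i′ A.i≡  B.i′≡ (trans (cong (parity (toℕ A.i) +ℙ_) B.flip-parity) (⁻¹-+ʳ (parity (toℕ A.i)) _)))
        (labels-at A.i′ B.i′ A.i′≡ B.i′≡ (trans (cong₂ _+ℙ_ A.flip-parity B.flip-parity) (twice (parity (toℕ A.i)) (parity (toℕ B.i)))))
        (+-exchange (ρ A.i) (ρ A.i′) (γ B.i) (γ B.i′))
        where
        module A = Step a<
        module B = Step b<
        twice : ∀ p q → (p ⁻¹) +ℙ (q ⁻¹) ≡ p +ℙ q
        twice 0ℙ 0ℙ = refl
        twice 0ℙ 1ℙ = refl
        twice 1ℙ 0ℙ = refl
        twice 1ℙ 1ℙ = refl

      sideways : ∀ a → suc a < m →
        sum4 (lab f a (m ∸ 1)) (lab f (suc a) (m ∸ 1)) (lab f (m ∸ 1 ∸ a) 0) (lab f (m ∸ 2 ∸ a) 0) ≡ magicSum φ (m * m)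
      -- Across the seam (i, last) meets (opposite i, zero), a cell of the same parity since m is
      -- odd. These pairs take the place of the diagonals of an inner face, with equal sums by
      -- `ρ-complement`; swapping the last two cells gives the order `quad` expects.
      sideways a a< = trans (sum4-swap (lab f a (m ∸ 1)) (lab f (suc a) (m ∸ 1)) (lab f (m ∸ 2 ∸ a) 0) (lab f (m ∸ 1 ∸ a) 0)) (quad φ (parity (toℕ A.i))
        (labels-at A.i  last A.i≡ last≡ (last-cell A.i))
        (labels-at A.i′ last A.i′≡ last≡ (trans (last-cell A.i′) A.flip-parity))
        (labels-at (opposite A.i′) zero A.o′≡ refl (trans (zero-cell A.i′) A.flip-parity))
        (labels-at (opposite A.i)  zero A.o≡  refl (zero-cell A.i))
        (balance (ρ A.i) (ρ (opposite A.i)) (ρ A.i′) (ρ (opposite A.i′)) (γ last) (γ zero) (ρ-complement A.i A.i′)))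
        where
        module A = Step a<
        last-cell : ∀ i → cell {m} {m} (i , last) ≡ parity (toℕ i)
        last-cell i = trans (cong (parity (toℕ i) +ℙ_) (parity-opposite zero)) (ℙ.+-identityʳ _)
        zero-cell : ∀ i → cell {m} {m} (opposite i , zero) ≡ parity (toℕ i)
        zero-cell i = trans (ℙ.+-identityʳ _) (parity-opposite i)
        balance : ∀ a b a′ b′ g g′ → a + b ≡ a′ + b′ → (a + g) + (b + g′) ≡ (a′ + g) + (b′ + g′)
        balance a b a′ b′ g g′ eq = trans (interchange a g b g′) (trans (cong (_+ (g + g′)) eq) (interchange a′ b′ g g′))

      upwards : ∀ b → suc b < m →
        sum4 (lab f (m ∸ 1) b) (lab f (m ∸ 1) (suc b)) (lab f 0 (m ∸ 1 ∸ b)) (lab f 0 (m ∸ 2 ∸ b)) ≡ magicSum φ (m * m)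
      upwards b b< = trans (sum4-swap (lab f (m ∸ 1) b) (lab f (m ∸ 1) (suc b)) (lab f 0 (m ∸ 2 ∸ b)) (lab f 0 (m ∸ 1 ∸ b))) (quad φ (parity (toℕ B.i))
        (labels-at last B.i  last≡ B.i≡ (last-cell B.i))
        (labels-at last B.i′ last≡ B.i′≡ (trans (last-cell B.i′) B.flip-parity))
        (labels-at zero (opposite B.i′) refl B.o′≡ (trans (parity-opposite B.i′) B.flip-parity))
        (labels-at zero (opposite B.i)  refl B.o≡  (parity-opposite B.i))
        (balance (γ B.i) (γ (opposite B.i)) (γ B.i′) (γ (opposite B.i′)) (ρ last) (ρ zero) (γ-complement B.i B.i′)))
        where
        module B = Step b<
        last-cell : ∀ j → cell {m} {m} (last , j) ≡ parity (toℕ j)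
        last-cell j = cong (_+ℙ parity (toℕ j)) (parity-opposite zero)
        balance : ∀ a b a′ b′ g g′ → a + b ≡ a′ + b′ → (g + a) + (g′ + b) ≡ (g + a′) + (g′ + b′)
        balance a b a′ b′ g g′ eq = trans (interchange g a g′ b) (trans (cong (g + g′ +_) eq) (interchange g g′ a′ b′))

    realises-labelling : IsLabeling m m f
    realises-labelling = vertex-injective⇒bijective realises-injective

-- Inequivalence and counting

-- The central cell is even and its value T satisfies N = 2T + 1, so twice its label is T + 2 in
-- `lower`, 2T + 2 in `plain` and 3T + 2 in `upper`.
centre-determines : ∀ φ ψ {T L} → T ≢ 0 → Labels φ (suc (T + T)) 0ℙ T L → Labels ψ (suc (T + T)) 0ℙ T L → φ ≡ ψ
centre-determines φ ψ {T} {L} T≢0 eφ eψ = go φ ψ eφ eψ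
  where
  doubled : Family → ℕ
  doubled plain = 2 * T + 2
  doubled lower = T + 2
  doubled upper = 3 * T + 2

  twice : ∀ φ → Labels φ (suc (T + T)) 0ℙ T L → 2 * L ≡ doubled φ
  twice plain e = trans (cong (2 *_) (trans (sym (ℕ.*-identityˡ L)) e)) (lemma T)
    where
    lemma : ∀ T → 2 * (T + 1) ≡ 2 * T + 2
    lemma = solve-∀
  twice lower e = e
  twice upper e = trans e (lemma T)
    where
    lemma : ∀ T → T + (suc (T + T) + 1) ≡ 3 * T + 2
    lemma = solve-∀

  T>0 : 0 < T
  T>0 = ℕ.n≢0⇒n>0 T≢0

  lower<plain : doubled lower < doubled plain
  lower<plain = ℕ.+-monoˡ-< 2 (ℕ.m<m+n T (ℕ.<-≤-trans T>0 (ℕ.m≤m+n T 0)))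

  plain<upper : doubled plain < doubled upper
  plain<upper = ℕ.+-monoˡ-< 2 (ℕ.m<n+m (2 * T) T>0)

  go : ∀ φ ψ → Labels φ (suc (T + T)) 0ℙ T L → Labels ψ (suc (T + T)) 0ℙ T L → φ ≡ ψ
  go plain plain _ _ = refl
  go lower lower _ _ = refl
  go upper upper _ _ = refl
  go lower plain e e′ = contradiction (trans (sym (twice lower e)) (twice plain e′)) (ℕ.<⇒≢ lower<plain)
  go plain lower e e′ = contradiction (trans (sym (twice lower e′)) (twice plain e)) (ℕ.<⇒≢ lower<plain)
  go plain upper e e′ = contradiction (trans (sym (twice plain e)) (twice upper e′)) (ℕ.<⇒≢ plain<upper)
  go upper plain e e′ = contradiction (trans (sym (twice plain e′)) (twice upper e)) (ℕ.<⇒≢ plain<upper)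
  go lower upper e e′ = contradiction (trans (sym (twice lower e)) (twice upper e′)) (ℕ.<⇒≢ (ℕ.<-trans lower<plain plain<upper))
  go upper lower e e′ = contradiction (trans (sym (twice lower e′)) (twice upper e)) (ℕ.<⇒≢ (ℕ.<-trans lower<plain plain<upper))

-- Induction on the value r of `a`: by surjectivity some element has value r - 1, and `b` places it
-- strictly lower. Used in both directions, this shows that a ranking is determined by its order.
order⇒≤ : ∀ {n} (a b : Fin n → Fin n) → Injective _≡_ _≡_ a →
  (∀ {i j} → toℕ (a i) < toℕ (a j) → toℕ (b i) < toℕ (b j)) → ∀ i → toℕ (a i) ≤ toℕ (b i)
order⇒≤ {n} a b inj mono i = go (toℕ (a i)) i refl
  where
  go : ∀ r i → toℕ (a i) ≡ r → r ≤ toℕ (b i)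
  go zero    i _  = z≤n
  go (suc r) i eq with injective⇒surjective inj (fromℕ< {r} {n} r<n)
    where
    r<n : r < n
    r<n = ℕ.<-trans (ℕ.n<1+n r) (subst (_< n) eq (toℕ<n (a i)))
  ... | j , aj≡ = ℕ.≤-<-trans (go r j toℕaj) (mono (subst₂ _<_ (sym toℕaj) (sym eq) (ℕ.n<1+n r)))
    where
    toℕaj : toℕ (a j) ≡ r
    toℕaj = trans (cong toℕ aj≡) (toℕ-fromℕ< _)

opposite-reverses : ∀ {n} {i j : Fin n} → toℕ i < toℕ j → toℕ (opposite j) < toℕ (opposite i)
opposite-reverses {n} {i} {j} i<j = subst₂ _<_ (sym (opposite-prop j)) (sym (opposite-prop i))
  (ℕ.∸-monoʳ-< (s≤s i<j) (toℕ<n j))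

lookup-injective : ∀ {A : Set} {xs : List A} → Unique xs → ∀ {i j} → lookupᴸ xs i ≡ lookupᴸ xs j → i ≡ j
lookup-injective (_ ∷ _)  {zero}  {zero}  _  = refl
lookup-injective (x ∷ _)  {zero}  {suc j} eq = contradiction eq (All.lookup x (∈-lookup j))
lookup-injective (x ∷ _)  {suc i} {zero}  eq = contradiction (sym eq) (All.lookup x (∈-lookup i))
lookup-injective (_ ∷ xs) {suc i} {suc j} eq = cong suc (lookup-injective xs eq)

module Counting (k : ℕ) where
  open Labelling k

  h : ℕ
  h = suc k

  toℕ-mid : toℕ mid ≡ h
  toℕ-mid = trans (toℕ-↑ʳ h (zero {h})) (ℕ.+-identityʳ h)

  1<m : 1 < m
  1<m = s≤s (ℕ.m≤n⇒m≤o+n k (s≤s z≤n))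

  odd-m : Odd m
  odd-m = trans (ℙ.+-homo-+ h (suc h)) (trans (cong (parity h +ℙ_) (parity-next {h} refl)) (ℙ.p+p⁻¹≡1ℙ (parity h)))

  odd-m*m : Odd (m * m)
  odd-m*m = trans (ℙ.*-homo-* m m) (cong₂ _*ℙ_ odd-m odd-m)

  -- rank-zero excludes the reversed ranking, which describes an equivalent labelling.
  record Ranking : Set where
    field
      rank          : Fin m → Fin m
      injective     : Injective _≡_ _≡_ rank
      rank-opposite : ∀ i → rank (opposite i) ≡ opposite (rank i)
      rank-mid      : rank mid ≡ mid
      rank-zero     : toℕ (rank zero) < h

    position : ∀ {r} → r < m → ∃ λ i → toℕ (rank i) ≡ r
    position r<m with injective⇒surjective injective (fromℕ< r<m)
    ... | i , eq = i , trans (cong toℕ eq) (toℕ-fromℕ< r<m)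

    first<mid : toℕ (rank zero) < toℕ (rank mid)
    first<mid = subst (toℕ (rank zero) <_) (sym (trans (cong toℕ rank-mid) toℕ-mid)) rank-zero

    mid<last : toℕ (rank mid) < toℕ (rank (opposite zero))
    mid<last = subst₂ (λ x y → toℕ x < toℕ y)
      (trans (sym (rank-opposite mid)) (cong rank opposite-mid)) (sym (rank-opposite zero))
      (opposite-reverses {i = rank zero} first<mid)

  open Ranking using (rank; position)

  rank-complement : ∀ R i → suc (toℕ (rank R i) + toℕ (rank R (opposite i))) ≡ m
  rank-complement R i = trans (cong (λ x → suc (toℕ (rank R i) + toℕ x)) (Ranking.rank-opposite R i))
                              (opposite-sum (rank R i))

  PreservesParity : Ranking → Set
  PreservesParity R = ∀ i → parity (toℕ (rank R i)) ≡ parity (toℕ i)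

  record Design : Set where
    field
      factors   : List ℕ
      big       : All (1 <_) factors
      rows≡m    : rows factors ≡ m
      cols≡m    : cols factors ≡ m
      family    : Family
      rowRank   : Ranking
      colRank   : Ranking
      parityOK  : family ≢ plain → PreservesParity rowRank × PreservesParity colRank

    row< : ∀ (i : Fin m) → toℕ i < rows factors
    row< i = subst (toℕ i <_) (sym rows≡m) (toℕ<n i)

    col< : ∀ (i : Fin m) → toℕ i < cols factors
    col< i = subst (toℕ i <_) (sym cols≡m) (toℕ<n i)

    area : rows factors * cols factors ≡ m * m
    area = cong₂ _*_ rows≡m cols≡m

    tiling : Tiling
    tiling = record
      { ρ          = λ i → rowVal factors (toℕ (rank rowRank i))
      ; γ          = λ j → colVal factors (toℕ (rank colRank j))
      ; bound      = λ i j → subst (rowVal factors (toℕ (rank rowRank i)) + colVal factors (toℕ (rank colRank j)) <_)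
                       area (rowVal+colVal-bound big (row< (rank rowRank i)) (col< (rank colRank j)))
      ; injective  = λ {i} {j} {i′} {j′} eq →
          let r , c = rowVal+colVal-injective big (row< (rank rowRank i)) (col< (rank colRank j))
                        (row< (rank rowRank i′)) (col< (rank colRank j′)) eq
          in Ranking.injective rowRank (toℕ-injective r) , Ranking.injective colRank (toℕ-injective c)
      ; complement = λ i j → trans (rowVal+colVal-complement big
                       (trans (rank-complement rowRank i) (sym rows≡m))
                       (trans (rank-complement colRank j) (sym cols≡m))) area
      }

    open Tiling tiling public

    value-parity : family ≢ plain → ∀ v → parity (value v) ≡ cell v
    value-parity φ≢plain (i , j) = trans (ℙ.+-homo-+ (ρ i) (γ j)) (cong₂ _+ℙ_
      (trans (rowVal-parity big allOdd (row< (rank rowRank i))) (proj₁ (parityOK φ≢plain) i))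
      (trans (colVal-parity big allOdd (col< (rank colRank j))) (proj₂ (parityOK φ≢plain) j)))
      where
      allOdd : All Odd factors
      allOdd = entries-odd factors (subst Odd (sym rows≡m) odd-m) (subst Odd (sym cols≡m) odd-m)

    labelled : ∀ v → ∃ λ (ℓ : Fin (m * m)) → Labels family (m * m) (cell v) (value v) (suc (toℕ ℓ))
    labelled v@(i , j) = label family (cell v) odd-m*m (bound i j) (λ φ≢plain → value-parity φ≢plain v)

    labelling : Vertex m m → Fin (m * m)
    labelling v = proj₁ (labelled v)

    realises : Realises family tiling labelling
    realises v = proj₂ (labelled v)

    magic : MagicLabeling m m
    magic = labelling , realises-labelling {family} {tiling} realises , realises-magic {family} {tiling} realises

    ρ-mono : ∀ {i i′} → toℕ (rank rowRank i) < toℕ (rank rowRank i′) → ρ i < ρ i′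
    ρ-mono {i′ = i′} lt = rowVal-mono big lt (row< (rank rowRank i′))

    γ-mono : ∀ {j j′} → toℕ (rank colRank j) < toℕ (rank colRank j′) → γ j < γ j′
    γ-mono {j′ = j′} lt = colVal-mono big lt (col< (rank colRank j′))

    -- The first factor exceeds 1 and belongs to the rows, so ranks 0 and 1 carry the row values 0
    -- and 1. This asymmetry of the axes rules out transposing symmetries.
    unitStep : ∃ λ i → ∃ λ i′ → ρ i ≡ 0 × ρ i′ ≡ 1
    unitStep with position rowRank {0} (s≤s z≤n) | position rowRank {1} 1<m
    ... | i , eq | i′ , eq′ = i , i′ , trans (cong (rowVal factors) eq) (rowVal-zero factors)
        , trans (cong (rowVal factors) eq′) (rowVal-one big (subst (1 <_) (sym rows≡m) 1<m))

    value-mid : suc (value (mid , mid) + value (mid , mid)) ≡ m * m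
    value-mid = subst (λ x → suc (value (mid , mid) + value (x , x)) ≡ m * m) opposite-mid (value-opposite mid mid)

    value-mid≢0 : value (mid , mid) ≢ 0
    value-mid≢0 eq = ℕ.<⇒≢ (ℕ.<-≤-trans 1<m (ℕ.m≤m*n m m)) (trans (cong (λ x → suc (x + x)) (sym eq)) value-mid)

  data Axial (u : Fin m → Fin m) : Set where
    keeps    : (∀ i → u i ≡ i) → Axial u
    reverses : (∀ i → u i ≡ opposite i) → Axial u

  -- Every symmetry acts on the two axes separately, possibly after exchanging them. Pointwise
  -- equations are used because a double `opposite` is the identity only propositionally.
  data Classified (σ : Vertex m m → Vertex m m) : Set where
    straight  : ∀ {u w} → Axial u → Axial w → (∀ i j → σ (i , j) ≡ (u i , w j)) → Classified σ
    transpose : ∀ {u w} → Axial u → Axial w → (∀ i j → σ (i , j) ≡ (u j , w i)) → Classified σ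

  classify : All Classified (symmetries m)
  classify =
      straight  (keeps λ _ → refl)    (keeps λ _ → refl)    (λ _ _ → refl)
    ∷ transpose (reverses λ _ → refl) (keeps λ _ → refl)    (λ _ _ → refl)
    ∷ straight  (reverses λ _ → refl) (reverses λ _ → refl) (λ _ _ → refl)
    ∷ transpose (keeps λ i → opposite-involutive i) (reverses λ _ → refl) (λ _ _ → refl)
    ∷ straight  (keeps λ _ → refl)    (reverses λ _ → refl) (λ _ _ → refl)
    ∷ transpose (keeps λ i → opposite-involutive i) (keeps λ _ → refl) (λ _ _ → refl)
    ∷ straight  (reverses λ _ → refl) (keeps λ i → opposite-involutive i) (λ _ _ → refl)
    ∷ transpose (reverses λ i → opposite-involutive (opposite i)) (reverses λ _ → refl) (λ _ _ → refl)
    ∷ []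

  axial-mid : ∀ {u} → Axial u → u mid ≡ mid
  axial-mid (keeps eq)    = eq mid
  axial-mid (reverses eq) = trans (eq mid) opposite-mid

  axial-id : ∀ {u} → Axial u → ¬ (∀ i → u i ≡ opposite i) → ∀ i → u i ≡ i
  axial-id (keeps eq)    _    = eq
  axial-id (reverses eq) ¬rev = contradiction eq ¬rev

  axial-parity : ∀ {u} → Axial u → ∀ i → parity (toℕ (u i)) ≡ parity (toℕ i)
  axial-parity (keeps eq)    i = cong (parity ∘ toℕ) (eq i)
  axial-parity (reverses eq) i = trans (cong (parity ∘ toℕ) (eq i)) (parity-opposite i)

  symmetry-mid : ∀ {σ} → Classified σ → σ (mid , mid) ≡ (mid , mid)
  symmetry-mid (straight  au aw eq) = trans (eq mid mid) (cong₂ _,_ (axial-mid au) (axial-mid aw))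
  symmetry-mid (transpose au aw eq) = trans (eq mid mid) (cong₂ _,_ (axial-mid au) (axial-mid aw))

  -- Reversing an axis of odd length preserves parity, and exchanging the axes only commutes the
  -- sum.
  symmetry-cell : ∀ {σ} → Classified σ → ∀ v → cell (σ v) ≡ cell v
  symmetry-cell (straight  au aw eq) (i , j) =
    trans (cong cell (eq i j)) (cong₂ _+ℙ_ (axial-parity au i) (axial-parity aw j))
  symmetry-cell (transpose au aw eq) (i , j) =
    trans (cong cell (eq i j)) (trans (cong₂ _+ℙ_ (axial-parity au j) (axial-parity aw i)) (ℙ.+-comm (parity (toℕ j)) (parity (toℕ i))))

  rank-unique : ∀ (R R′ : Ranking) (v v′ : Fin m → ℕ) →
    (∀ {i j} → toℕ (rank R i) < toℕ (rank R j) → v i < v j) →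
    (∀ {i j} → toℕ (rank R′ i) < toℕ (rank R′ j) → v′ i < v′ j) →
    (∀ {i j} → v i < v j → v′ i < v′ j) → (∀ {i j} → v′ i < v′ j → v i < v j) → rank R ≗ rank R′
  rank-unique R R′ v v′ mono mono′ to from i = toℕ-injective (ℕ.≤-antisym
    (order⇒≤ _ _ (Ranking.injective R)  (λ lt → reflect R′ v′ mono′ (to (mono lt))) i)
    (order⇒≤ _ _ (Ranking.injective R′) (λ lt → reflect R v mono (from (mono′ lt))) i))
    where
    reflect : ∀ R v → (∀ {i j} → toℕ (rank R i) < toℕ (rank R j) → v i < v j) →
              ∀ {i j} → v i < v j → toℕ (rank R i) < toℕ (rank R j)
    reflect R v mono {i} {j} vi<vj with ℕ.<-cmp (toℕ (rank R i)) (toℕ (rank R j))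
    ... | tri< lt _ _ = lt
    ... | tri≈ _ eq _ with Ranking.injective R (toℕ-injective eq)
    ...   | refl = contradiction vi<vj (ℕ.<-irrefl refl)
    reflect R v mono {i} {j} vi<vj | tri> _ _ gt =
      contradiction (ℕ.<-trans vi<vj (mono gt)) (ℕ.<-irrefl refl)

  module _ (D E : Design) where
    private
      module D = Design D
      module E = Design E

    record Agree : Set where
      field
        factors≡ : D.factors ≡ E.factors
        family≡  : D.family ≡ E.family
        rowRank≗ : rank D.rowRank ≗ rank E.rowRank
        colRank≗ : rank D.colRank ≗ rank E.colRank

    module _ {σ} (class : Classified σ) (sym-eq : ∀ v → E.labelling v ≡ D.labelling (σ v)) where

      -- Every symmetry fixes the centre, and both tilings have the value (m * m - 1) / 2 there.
      family-eq : D.family ≡ E.family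
      family-eq = centre-determines D.family E.family D.value-mid≢0
        (at-mid D.family D.value-mid (D.realises (mid , mid)))
        (subst₂ (λ t ℓ → Labels E.family (suc (D.value c + D.value c)) 0ℙ t (suc (toℕ ℓ)))
           E≡D (trans (sym-eq c) (cong D.labelling (symmetry-mid class)))
           (subst (λ t → Labels E.family (suc (t + t)) 0ℙ (E.value c) (suc (toℕ (E.labelling c)))) E≡D
             (at-mid E.family E.value-mid (E.realises c))))
        where
        c : Vertex m m
        c = mid , mid
        at-mid : ∀ φ {N t L} → suc (t + t) ≡ N → Labels φ N (cell c) t L → Labels φ (suc (t + t)) 0ℙ t L
        at-mid φ {L = L} refl = subst (λ p → Labels φ _ p _ L) (ℙ.p+p≡0ℙ (parity (toℕ mid)))
        E≡D : E.value c ≡ D.value c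
        E≡D = ℕ.≤-antisym (double-cancel-≤ _ _ (ℕ.≤-reflexive eq)) (double-cancel-≤ _ _ (ℕ.≤-reflexive (sym eq)))
          where
          eq : E.value c + E.value c ≡ D.value c + D.value c
          eq = ℕ.suc-injective (trans E.value-mid (sym D.value-mid))

      -- Once families and cell parities coincide, both labels depend on the value by the same
      -- injective affine rule.
      value-eq : ∀ v → E.value v ≡ D.value (σ v)
      value-eq v = Labels-injective D.family (cell v)
        (subst₂ (λ φ ℓ → Labels φ (m * m) (cell v) (E.value v) (suc (toℕ ℓ))) (sym family-eq) (sym-eq v) (E.realises v))
        (subst (λ p → Labels D.family (m * m) p (D.value (σ v)) (suc (toℕ (D.labelling (σ v))))) (symmetry-cell class v) (D.realises (σ v)))

    -- Consecutive row values of E would become consecutive column values of D,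
    -- but D already has consecutive row values and its tiling is injective.
    ¬transposed : ∀ {u w : Fin m → Fin m} → ¬ (∀ i j → E.value (i , j) ≡ D.value (u j , w i))
    ¬transposed {u} {w} eq with E.unitStep | D.unitStep
    ... | a₀ , a₁ , ρa₀ , ρa₁ | c₀ , c₁ , ρc₀ , ρc₁ =
      contradiction (trans (sym ρc₀) (trans (cong D.ρ (sym c₁≡c₀)) ρc₁)) (λ ())
      where
      step : D.γ (w a₁) ≡ suc (D.γ (w a₀))
      step = ℕ.+-cancelˡ-≡ (D.ρ (u zero)) _ _ (begin
        D.ρ (u zero) + D.γ (w a₁)       ≡⟨ eq a₁ zero ⟨
        E.ρ a₁ + E.γ zero               ≡⟨ cong (_+ E.γ zero) ρa₁ ⟩
        suc (E.γ zero)                  ≡⟨ cong (λ r → suc (r + E.γ zero)) ρa₀ ⟨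
        suc (E.ρ a₀ + E.γ zero)         ≡⟨ cong suc (eq a₀ zero) ⟩
        suc (D.ρ (u zero) + D.γ (w a₀)) ≡⟨ ℕ.+-suc (D.ρ (u zero)) (D.γ (w a₀)) ⟨
        D.ρ (u zero) + suc (D.γ (w a₀)) ∎)
        where open ≡-Reasoning
      c₁≡c₀ : c₁ ≡ c₀
      c₁≡c₀ = proj₁ (D.injective {c₁} {w a₀} {c₀} {w a₁} (trans (cong (_+ D.γ (w a₀)) ρc₁) (trans (sym step) (cong (_+ D.γ (w a₁)) (sym ρc₀)))))

    module Straight {u w} (au : Axial u) (aw : Axial w) (eq : ∀ i j → E.value (i , j) ≡ D.value (u i , w j)) where

      -- Freezing the column at `zero` transfers the order of the row values from E to D; the three
      -- companions do the same for the converse and for the columns.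
      ρ-order : ∀ {i i′} → E.ρ i < E.ρ i′ → D.ρ (u i) < D.ρ (u i′)
      ρ-order {i} {i′} lt = ℕ.+-cancelʳ-< (D.γ (w zero)) _ _
        (subst₂ _<_ (eq i zero) (eq i′ zero) (ℕ.+-monoˡ-< (E.γ zero) lt))

      ρ-order⁻ : ∀ {i i′} → D.ρ (u i) < D.ρ (u i′) → E.ρ i < E.ρ i′
      ρ-order⁻ {i} {i′} lt = ℕ.+-cancelʳ-< (E.γ zero) _ _
        (subst₂ _<_ (sym (eq i zero)) (sym (eq i′ zero)) (ℕ.+-monoˡ-< (D.γ (w zero)) lt))

      γ-order : ∀ {j j′} → E.γ j < E.γ j′ → D.γ (w j) < D.γ (w j′)
      γ-order {j} {j′} lt = ℕ.+-cancelˡ-< (D.ρ (u zero)) _ _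
        (subst₂ _<_ (eq zero j) (eq zero j′) (ℕ.+-monoʳ-< (E.ρ zero) lt))

      γ-order⁻ : ∀ {j j′} → D.γ (w j) < D.γ (w j′) → E.γ j < E.γ j′
      γ-order⁻ {j} {j′} lt = ℕ.+-cancelˡ-< (E.ρ zero) _ _
        (subst₂ _<_ (sym (eq zero j)) (sym (eq zero j′)) (ℕ.+-monoʳ-< (D.ρ (u zero)) lt))

      -- A reversal would put the last row value of D below the middle one, whereas a `Ranking`
      -- starts below the middle and so ends above it.
      u-id : ∀ i → u i ≡ i
      u-id = axial-id au λ opp → contradiction
        (subst₂ (λ x y → D.ρ x < D.ρ y) (opp zero) (axial-mid au) (ρ-order (E.ρ-mono (Ranking.first<mid E.rowRank))))
        (ℕ.<-asym (D.ρ-mono (Ranking.mid<last D.rowRank)))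

      w-id : ∀ j → w j ≡ j
      w-id = axial-id aw λ opp → contradiction
        (subst₂ (λ x y → D.γ x < D.γ y) (opp zero) (axial-mid aw) (γ-order (E.γ-mono (Ranking.first<mid E.colRank))))
        (ℕ.<-asym (D.γ-mono (Ranking.mid<last D.colRank)))

      rowRank≗ : rank D.rowRank ≗ rank E.rowRank
      rowRank≗ = rank-unique D.rowRank E.rowRank D.ρ E.ρ D.ρ-mono E.ρ-mono
        (λ {i} {j} lt → ρ-order⁻ (subst₂ (λ x y → D.ρ x < D.ρ y) (sym (u-id i)) (sym (u-id j)) lt))
        (λ {i} {j} lt → subst₂ (λ x y → D.ρ x < D.ρ y) (u-id i) (u-id j) (ρ-order lt))

      colRank≗ : rank D.colRank ≗ rank E.colRank
      colRank≗ = rank-unique D.colRank E.colRank D.γ E.γ D.γ-mono E.γ-mono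
        (λ {i} {j} lt → γ-order⁻ (subst₂ (λ x y → D.γ x < D.γ y) (sym (w-id i)) (sym (w-id j)) lt))
        (λ {i} {j} lt → subst₂ (λ x y → D.γ x < D.γ y) (w-id i) (w-id j) (γ-order lt))

      vals : ∀ {r c} → r < m → c < m →
             rowVal D.factors r + colVal D.factors c ≡ rowVal E.factors r + colVal E.factors c
      vals {r} {c} r< c< with position E.rowRank r< | position E.colRank c<
      ... | i , refl | j , refl = sym (trans (eq i j) (cong₂ (λ x y → rowVal D.factors (toℕ x) + colVal D.factors (toℕ y))
        (trans (cong (rank D.rowRank) (u-id i)) (rowRank≗ i)) (trans (cong (rank D.colRank) (w-id j)) (colRank≗ j))))

      factors≡ : D.factors ≡ E.factors
      factors≡ = sequence-unique D.big E.big (trans D.rows≡m (sym E.rows≡m)) (trans D.cols≡m (sym E.cols≡m))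
        -- Rank 0 has value 0 on either axis: c = 0 isolates the row values, up to a trailing zero
        -- that is cancelled, and r = 0 the column values.
        (λ r r< → ℕ.+-cancelʳ-≡ 0 _ _ (subst₂ (λ x y → rowVal D.factors r + x ≡ rowVal E.factors r + y)
          (colVal-zero D.factors) (colVal-zero E.factors) (vals (subst (r <_) D.rows≡m r<) (s≤s z≤n))))
        (λ c c< → subst₂ (λ x y → x + colVal D.factors c ≡ y + colVal E.factors c)
          (rowVal-zero D.factors) (rowVal-zero E.factors) (vals (s≤s z≤n) (subst (c <_) D.cols≡m c<)))

    agree-classified : ∀ {σ} → Classified σ → (∀ v → E.labelling v ≡ D.labelling (σ v)) → Agree
    agree-classified class@(straight au aw eqσ) eq = record
      { factors≡ = S.factors≡ ; family≡ = family-eq class eq ; rowRank≗ = S.rowRank≗ ; colRank≗ = S.colRank≗ }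
      where module S = Straight au aw (λ i j → trans (value-eq class eq (i , j)) (cong D.value (eqσ i j)))
    agree-classified class@(transpose au aw eqσ) eq =
      contradiction (λ i j → trans (value-eq class eq (i , j)) (cong D.value (eqσ i j))) ¬transposed

    equivalent⇒agree : Equivalent D.labelling E.labelling → Agree
    equivalent⇒agree any = let class , eq = All.lookupAny classify any in agree-classified class eq

  -- The pair of position `zero` is never reversed, which keeps the rank of `zero` below h. Each
  -- axis has k free signs, so both together give 2 ^ (2 * k) = 2 ^ (m - 3).
  signs : Vec Bool k → Fin h → Bool
  signs v = lookup (false ∷ v)

  ranking : Vec Bool k → (p : Fin h → Fin h) → Injective _≡_ _≡_ p → Ranking
  ranking v p inj = record
    { rank          = arrange (signs v) p
    ; injective     = arrange-injective (signs v) inj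
    ; rank-opposite = arrange-opposite (signs v) p
    ; rank-mid      = arrange-mid (signs v) p
    ; rank-zero     = subst (_< h) (sym (toℕ-↑ˡ (p zero) (suc h))) (toℕ<n (p zero))
    }

  signs-determine : ∀ v v′ → signs v ≗ signs v′ → v ≡ v′
  signs-determine v v′ eq = trans (sym (tabulate∘lookup v)) (trans (tabulate-cong (eq ∘ suc)) (tabulate∘lookup v′))

  Half ParityHalf : Set
  Half       = Vec Bool k × LehmerCode h
  ParityHalf = Vec Bool k × PairCode h

  halfRanking : Half → Ranking
  halfRanking (v , c) = ranking v (perm c) (perm-injective c)

  parityRanking : ParityHalf → Ranking
  parityRanking (v , c) = ranking v (parityPerm c) (parityPerm-injective c)

  parityRanking-parity : ∀ x → PreservesParity (parityRanking x)
  parityRanking-parity (v , c) = arrange-parity (signs v) (parityPerm c) (parityPerm-parity c)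

  halfRanking-determines : ∀ x y → rank (halfRanking x) ≗ rank (halfRanking y) → x ≡ y
  halfRanking-determines (v , c) (v′ , c′) eq with arrange-determines eq
  ... | eqε , eqp = cong₂ _,_ (signs-determine v v′ eqε) (perm-determines c c′ eqp)

  parityRanking-determines : ∀ x y → rank (parityRanking x) ≗ rank (parityRanking y) → x ≡ y
  parityRanking-determines (v , c) (v′ , c′) eq with arrange-determines eq
  ... | eqε , eqp = cong₂ _,_ (signs-determine v v′ eqε) (parityPerm-determines c c′ eqp)

  module _ (T : List (List ℕ)) (unique : Unique T) (all : ∀ s → s ∈ T → IsProjFactSeq m m s) where

    Index : Set
    Index = Fin (length T) × (Half × Half ⊎ Bool × ParityHalf × ParityHalf)

    shifted : Bool → Family
    shifted false = lower
    shifted true  = upper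

    design : Index → Design
    design (i , rest) with all (lookupᴸ T i) (∈-lookup i)
    design (i , inj₁ (x , y)) | big , _ , rows≡ , cols≡ = record
      { factors = lookupᴸ T i ; big = big ; rows≡m = rows≡ ; cols≡m = cols≡ ; family = plain
      ; rowRank = halfRanking x ; colRank = halfRanking y
      ; parityOK = λ ¬plain → contradiction refl ¬plain }
    design (i , inj₂ (b , x , y)) | big , _ , rows≡ , cols≡ = record
      { factors = lookupᴸ T i ; big = big ; rows≡m = rows≡ ; cols≡m = cols≡ ; family = shifted b
      ; rowRank = parityRanking x ; colRank = parityRanking y
      ; parityOK = λ _ → parityRanking-parity x , parityRanking-parity y }

    shifted-injective : ∀ {b c} → shifted b ≡ shifted c → b ≡ c
    shifted-injective {false} {false} _ = refl
    shifted-injective {true}  {true}  _ = refl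

    shifted≢plain : ∀ b → shifted b ≢ plain
    shifted≢plain false ()
    shifted≢plain true  ()

    agree⇒≡ : ∀ x y → Agree (design x) (design y) → x ≡ y
    agree⇒≡ (i , inj₁ (x , y)) (i′ , inj₁ (x′ , y′)) record { factors≡ = f ; rowRank≗ = r ; colRank≗ = c } =
      cong₂ _,_ (lookup-injective unique f)
        (cong inj₁ (cong₂ _,_ (halfRanking-determines x x′ r) (halfRanking-determines y y′ c)))
    agree⇒≡ (i , inj₂ (b , x , y)) (i′ , inj₂ (b′ , x′ , y′)) record { factors≡ = f ; family≡ = φ ; rowRank≗ = r ; colRank≗ = c } =
      cong₂ _,_ (lookup-injective unique f)
        (cong inj₂ (cong₂ _,_ (shifted-injective φ)
          (cong₂ _,_ (parityRanking-determines x x′ r) (parityRanking-determines y y′ c))))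
    agree⇒≡ (i , inj₁ _) (i′ , inj₂ (b , _)) record { family≡ = φ } = contradiction (sym φ) (shifted≢plain b)
    agree⇒≡ (i , inj₂ (b , _)) (i′ , inj₁ _) record { family≡ = φ } = contradiction φ (shifted≢plain b)

    halves parityHalves size : ℕ
    halves       = 2 ^ k * h !
    parityHalves = 2 ^ k * (⌈ h /2⌉ ! * ⌊ h /2⌋ !)
    size         = length T * (halves * halves + 2 * (parityHalves * parityHalves))

    ↣-* : ∀ {a b} {A B : Set} → Fin a ↣ A → Fin b ↣ B → Fin (a * b) ↣ (A × B)
    ↣-* {a} f g = (f ×-↣ g) ↣-∘ ↔⇒↣ (*↔× {a})

    index : Fin size ↣ Index
    index = ↣-* (↣-id _) ((↣-* half half ⊎-↣ ↣-* (↔⇒↣ 2↔Bool) (↣-* parityHalf parityHalf)) ↣-∘ ↔⇒↣ (+↔⊎ {halves * halves}))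
      where
      half : Fin halves ↣ Half
      half = ↣-* (Fin2^↣Vec k) (Fin!↣Code h)
      parityHalf : Fin parityHalves ↣ ParityHalf
      parityHalf = ↣-* (Fin2^↣Vec k) (↣-* (Fin!↣Code ⌈ h /2⌉) (Fin!↣Code ⌊ h /2⌋))

    -- Equivalent labellings have agreeing designs, agreeing designs have equal indices, and `index`
    -- is injective.
    labelings : Σ (List (MagicLabeling m m)) λ Ls →
      AllPairs (λ x y → ¬ Equivalent (proj₁ x) (proj₁ y)) Ls × length Ls ≡ size
    labelings = tabulate (λ n → Design.magic (design (to n)))
      , tabulate⁺ (λ {i} {j} i≢j equiv → i≢j (injective (agree⇒≡ (to i) (to j)
          (equivalent⇒agree (design (to i)) (design (to j)) equiv))))
      , length-tabulate _
      where open Injection index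

-- Arithmetic of the bound

β-value : ∀ h → β (h + suc h) ≡ ⌈ h /2⌉ ! * ⌊ h /2⌋ !
β-value h with parity h in p
-- Here h = 2u and m = 4u + 1, so both factorials are u !.
... | 0ℙ with even-half h p
...   | u , refl = trans (cong β m≡) (begin
    β (1 + u * 4)                   ≡⟨ cong (λ r → if r ≡ᵇ 1 then e else o) ([m+kn]%n≡m%n 1 u 4) ⟩
    (u * 4 / 4) ! * (u * 4 / 4) !   ≡⟨ cong (λ x → x ! * x !) (m*n/n≡m u 4) ⟩
    u ! * u !                       ≡⟨ cong₂ (λ x y → x ! * y !) (ℕ.n≡⌈n+n/2⌉ u) (ℕ.n≡⌊n+n/2⌋ u) ⟩
    ⌈ u + u /2⌉ ! * ⌊ u + u /2⌋ !   ∎)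
  where
  open ≡-Reasoning
  e = (u * 4 / 4) ! * (u * 4 / 4) !
  o = ((1 + u * 4 ∸ 3) / 4) ! * ((1 + u * 4 + 1) / 4) !
  m≡ : u + u + suc (u + u) ≡ 1 + u * 4
  m≡ = lemma u
    where
    lemma : ∀ u → u + u + suc (u + u) ≡ 1 + u * 4
    lemma = solve-∀
-- Here h = 2u + 1 and m = 4u + 3, so the factorials are u ! and (u + 1) !.
β-value h | 1ℙ with odd-half h p
...   | u , refl = trans (cong β m≡) (begin
    β (3 + u * 4)                         ≡⟨ cong (λ r → if r ≡ᵇ 1 then e else o) ([m+kn]%n≡m%n 3 u 4) ⟩
    (u * 4 / 4) ! * ((3 + u * 4 + 1) / 4) ! ≡⟨ cong₂ (λ x y → x ! * y !) (m*n/n≡m u 4)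
                                               (trans (cong (_/ 4) (ℕ.+-comm (3 + u * 4) 1)) (m*n/n≡m (suc u) 4)) ⟩
    u ! * suc u !                         ≡⟨ ℕ.*-comm (u !) (suc u !) ⟩
    suc u ! * u !                         ≡⟨ cong₂ (λ x y → suc x ! * y !) (ℕ.n≡⌊n+n/2⌋ u) (ℕ.n≡⌈n+n/2⌉ u) ⟩
    suc ⌊ u + u /2⌋ ! * ⌈ u + u /2⌉ !     ∎)
  where
  open ≡-Reasoning
  e = ((3 + u * 4 ∸ 1) / 4) ! * ((3 + u * 4 ∸ 1) / 4) !
  o = (u * 4 / 4) ! * ((3 + u * 4 + 1) / 4) !
  m≡ : suc (u + u) + suc (suc (u + u)) ≡ 3 + u * 4
  m≡ = lemma u
    where
    lemma : ∀ u → suc (u + u) + suc (suc (u + u)) ≡ 3 + u * 4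
    lemma = solve-∀

-- The shape is h + suc h with h = suc k, so that h is positive and position `zero` lies on a side.
odd-shape : ∀ m → 3 ≤ m → m % 2 ≡ 1 → ∃ λ k → m ≡ suc k + suc (suc k)
odd-shape m 3≤m odd with m / 2 | trans (m≡m%n+[m/n]*n m 2) (cong (_+ m / 2 * 2) odd)
... | zero  | refl = contradiction 3≤m λ { (s≤s ()) }
... | suc k | eq   = k , trans eq (lemma k)
  where
  lemma : ∀ k → 1 + suc k * 2 ≡ suc k + suc (suc k)
  lemma = solve-∀

bound≡size : ∀ k t → let h = suc k ; m = h + suc h ; E = 2 ^ k * (⌈ h /2⌉ ! * ⌊ h /2⌋ !) in
  t * 2 ^ (m ∸ 3) * (((m ∸ 1) / 2) ! * ((m ∸ 1) / 2) ! + 2 * (β m * β m))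
  ≡ t * ((2 ^ k * h !) * (2 ^ k * h !) + 2 * (E * E))
bound≡size k t = begin
  t * 2 ^ (m ∸ 3) * (((m ∸ 1) / 2) ! * ((m ∸ 1) / 2) ! + 2 * (β m * β m))
    ≡⟨ cong₂ (λ x y → t * x * (y ! * y ! + 2 * (β m * β m))) power half ⟩
  t * (2 ^ k * 2 ^ k) * (suc k ! * suc k ! + 2 * (β m * β m))
    ≡⟨ cong (λ b → t * (2 ^ k * 2 ^ k) * (suc k ! * suc k ! + 2 * (b * b))) (β-value (suc k)) ⟩
  t * (2 ^ k * 2 ^ k) * (suc k ! * suc k ! + 2 * (b * b))
    ≡⟨ lemma t (2 ^ k) (suc k !) b ⟩
  t * ((2 ^ k * suc k !) * (2 ^ k * suc k !) + 2 * ((2 ^ k * b) * (2 ^ k * b))) ∎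
  where
  open ≡-Reasoning
  m = suc k + suc (suc k)
  b = ⌈ suc k /2⌉ ! * ⌊ suc k /2⌋ !
  -- As m - 3 = 2k, one factor counts the signs of the rows and one those of the columns.
  power : 2 ^ (m ∸ 3) ≡ 2 ^ k * 2 ^ k
  power = trans (cong (λ x → 2 ^ (x ∸ 2)) (trans (ℕ.+-suc k (suc k)) (cong suc (ℕ.+-suc k k)))) (ℕ.^-distribˡ-+-* 2 k k)
  half : (m ∸ 1) / 2 ≡ suc k
  half = trans (cong (_/ 2) (double k)) (m*n/n≡m (suc k) 2)
    where
    double : ∀ k → k + suc (suc k) ≡ suc k * 2
    double = solve-∀
  lemma : ∀ t p f b → t * (p * p) * (f * f + 2 * (b * b)) ≡ t * ((p * f) * (p * f) + 2 * ((p * b) * (p * b)))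
  lemma = solve-∀

theorem45 : (m : ℕ) → 3 ≤ m → m % 2 ≡ 1 →
    (T : List (List ℕ)) → Unique T → (∀ s → (s ∈ T) ⇔ IsProjFactSeq m m s) →
    Σ (List (MagicLabeling m m)) λ Ls →
    AllPairs (λ x y → ¬ Equivalent (proj₁ x) (proj₁ y)) Ls
    × length T * 2 ^ (m ∸ 3) * (((m ∸ 1) / 2) ! * ((m ∸ 1) / 2) ! + 2 * (β m * β m))
    ≤ length Ls
theorem45 m 3≤m odd T unique char with odd-shape m 3≤m odd
... | k , refl =
  let Ls , separated , count = Counting.labelings k T unique (λ s → Equivalence.to (char s))
  in Ls , separated , ℕ.≤-reflexive (trans (bound≡size k (length T)) (sym count))
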